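{- There exist two positive constants $c_1$ and $c_2$ such that for any positive integer $k$, $$c_1\frac{1}{k}\binom{2k+1}{k} \le tw(BK(2k+1, k)) \le tw(J(2k+1,k)) \le c_2\binom{2k+1}{k}.$$
   Context: The bipartite Kneser graph $BK(n,k)$ ($n\ge 2k+1$) is the bipartite graph whose two parts are the family of all $k$-subsets of $[n]=\{1,\dots,n\}$ and the family of all $(n-k)$-subsets of $[n]$, a $k$-subset $A$ and an $(n-k)$-subset $B$ being adjacent iff $A\subseteq B$. The Johnson graph $J(n,k)$ has as vertices all $k$-subsets of $[n]$, two being adjacent iff their intersection has exactly $k-1$ elements. $tw(G)$ denotes treewidth. -}

module Defs where

open import Data.Empty using (⊥)
open import Data.Fin.Base using (Fin; zero)
open import Data.Fin.Subset using (Subset; inside; outside; ∣_∣; _∩_; _⊆_)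
open import Data.Fin.Subset.Properties using (_⊆?_; ∩-comm; ∩-idem)
open import Data.Bool.Properties using () renaming (_≟_ to _≟ᵇ_)
open import Data.Integer.Base using (+_)
open import Data.List.Base using (List; []; _∷_; [_]; _∷ʳ_; _++_; map; length; deduplicate)
open import Data.List.Membership.Propositional using (_∈_)
open import Data.List.Membership.Propositional.Properties
  using (∈-map⁺; ∈-++⁺ˡ; ∈-++⁺ʳ; ∈-deduplicate⁺)
open import Data.List.Relation.Unary.Any using (here)
open import Data.List.Relation.Unary.Linked using (Linked; _∷_)
open import Data.List.Relation.Unary.Unique.Propositional using (Unique)
import Data.List.Relation.Unary.Unique.DecPropositional.Properties as UniqueDec
open import Data.Nat.Base using (ℕ; zero; suc; _∸_; _⊔_; _≤_; _<_)
open import Data.Nat.Induction using (<-rec)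
open import Data.Nat.Properties using (≤-antisym; ≮⇒≥; 1+n≢n)
  renaming (_≟_ to _≟ⁿ_; ≡-irrelevant to ≡ⁿ-irrelevant)
open import Data.Product.Base using (Σ; ∃; _×_; _,_; proj₁; proj₂)
open import Data.Rational.Base using (ℚ; _/_)
open import Data.Sum.Base using (_⊎_; inj₁; inj₂)
open import Data.Sum.Properties using () renaming (≡-dec to ⊎-≡-dec)
open import Data.Vec.Base using ([]; _∷_)
open import Data.Vec.Properties using () renaming (≡-dec to Vec-≡-dec)
open import Data.Vec.Functional using (foldr)
open import Level using (0ℓ)
open import Relation.Binary.Core using (Rel)
open import Relation.Binary.Construct.Closure.ReflexiveTransitive using (Star; ε)
open import Relation.Binary.Definitions using (Symmetric; Irreflexive; Decidable; DecidableEquality)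
open import Relation.Binary.PropositionalEquality using (_≡_; refl; sym; trans; cong)
open import Relation.Nullary.Decidable using (yes; no)
open import Relation.Nullary.Negation using (¬_)

record SimpleGraph (V : Set) : Set₁ where
  infix 4 _~_ _~?_
  field
    _~_      : Rel V 0ℓ
    _~?_     : Decidable _~_
    ~-sym    : Symmetric _~_
    ~-irrefl : Irreflexive _≡_ _~_

  Connected : Set
  Connected = ∀ u v → Star _~_ u v

  -- A cycle: at least three pairwise distinct vertices, consecutive ones
  -- adjacent, and the last one adjacent to the first.
  Cycle : Set
  Cycle = Σ V λ x → Σ V λ y → Σ V λ z → Σ (List V) λ zs →
    Unique (x ∷ y ∷ z ∷ zs) × Linked _~_ ((x ∷ y ∷ z ∷ zs) ∷ʳ x)

  record IsTree : Set where
    field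
      root      : V   -- only says that a tree is nonempty
      connected : Connected
      acyclic   : ¬ Cycle

record TreeDecomposition {V : Set} (G : SimpleGraph V) : Set₁ where
  open SimpleGraph G using (_~_)
  field
    nodes  : ℕ
    tree   : SimpleGraph (Fin nodes)
    isTree : SimpleGraph.IsTree tree
    -- Bags are finite sets of vertices, given as duplicate-free lists,
    -- so that the length of a bag is its cardinality.
    bag        : Fin nodes → List V
    bag-unique : ∀ i → Unique (bag i)

  open SimpleGraph tree using () renaming (_~_ to _~ᵀ_)

  field
    vertex-covered : ∀ v → ∃ λ i → v ∈ bag i
    edge-covered   : ∀ {u v} → u ~ v → ∃ λ i → u ∈ bag i × v ∈ bag i
    -- The nodes whose bags contain v induce a connected subgraph of the tree.
    bags-connected : ∀ v {i j} → v ∈ bag i → v ∈ bag j →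
      Star (λ a b → a ~ᵀ b × v ∈ bag a × v ∈ bag b) i j

  -- Truncated subtraction matters only when all bags, hence G, are empty.
  width : ℕ
  width = foldr _⊔_ 0 (λ i → length (bag i)) ∸ 1

open TreeDecomposition using (width)

-- tw(G) = t: the least width of a tree decomposition of G is t.
record HasTreewidth {V : Set} (G : SimpleGraph V) (t : ℕ) : Set₁ where
  field
    attained : Σ (TreeDecomposition G) λ D → width D ≡ t
    minimal  : (D : TreeDecomposition G) → t ≤ width D

KSubset : ℕ → ℕ → Set
KSubset n k = Σ (Subset n) λ A → ∣ A ∣ ≡ k

Johnson : ∀ n k → SimpleGraph (KSubset n k)
Johnson n k = record
  { _~_      = λ A B → suc ∣ proj₁ A ∩ proj₁ B ∣ ≡ k
  ; _~?_     = λ A B → suc ∣ proj₁ A ∩ proj₁ B ∣ ≟ⁿ k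
  ; ~-sym    = λ {A} {B} → trans (cong (λ X → suc ∣ X ∣) (∩-comm (proj₁ B) (proj₁ A)))
  ; ~-irrefl = λ { {A , |A|≡k} refl e →
      1+n≢n (trans (cong (λ X → suc ∣ X ∣) (sym (∩-idem A))) (trans e (sym |A|≡k))) }
  }

-- The vertex type is the disjoint union of the two parts; for n ≥ 2k+1 the
-- parts are disjoint families of subsets anyway.
BKVertex : ℕ → ℕ → Set
BKVertex n k = KSubset n k ⊎ KSubset n (n ∸ k)

module _ {n k : ℕ} where

  BKAdj : Rel (BKVertex n k) 0ℓ
  BKAdj (inj₁ A) (inj₂ B) = proj₁ A ⊆ proj₁ B
  BKAdj (inj₂ B) (inj₁ A) = proj₁ A ⊆ proj₁ B
  BKAdj (inj₁ _) (inj₁ _) = ⊥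
  BKAdj (inj₂ _) (inj₂ _) = ⊥

  BKAdj? : Decidable BKAdj
  BKAdj? (inj₁ A) (inj₂ B) = proj₁ A ⊆? proj₁ B
  BKAdj? (inj₂ B) (inj₁ A) = proj₁ A ⊆? proj₁ B
  BKAdj? (inj₁ _) (inj₁ _) = no λ ()
  BKAdj? (inj₂ _) (inj₂ _) = no λ ()

  BKAdj-sym : Symmetric BKAdj
  BKAdj-sym {inj₁ _} {inj₂ _} A⊆B = A⊆B
  BKAdj-sym {inj₂ _} {inj₁ _} A⊆B = A⊆B

  BKAdj-irrefl : Irreflexive _≡_ BKAdj
  BKAdj-irrefl {inj₁ _} refl ()
  BKAdj-irrefl {inj₂ _} refl ()

BipartiteKneser : ∀ n k → SimpleGraph (BKVertex n k)
BipartiteKneser n k = record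
  { _~_      = BKAdj
  ; _~?_     = BKAdj?
  ; ~-sym    = λ {u} {v} → BKAdj-sym {x = u} {y = v}
  ; ~-irrefl = BKAdj-irrefl
  }

ℕ→ℚ : ℕ → ℚ
ℕ→ℚ m = + m / 1

-- The rest shows that treewidth, treated as a relation, determines a unique
-- number for each of the graphs above. Existence is stated up to double
-- negation: picking a minimum over all tree decompositions is not constructive
-- as it stands.

HasTreewidth-unique : ∀ {V} {G : SimpleGraph V} {s t} →
  HasTreewidth G s → HasTreewidth G t → s ≡ t
HasTreewidth-unique p q = ≤-antisym (below p q) (below q p)
  where
  open HasTreewidth
  below : ∀ {V} {G : SimpleGraph V} {s t} → HasTreewidth G s → HasTreewidth G t → s ≤ t
  below p q with attained q
  ... | D , refl = minimal p D

singleNode : SimpleGraph (Fin 1)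
singleNode = record
  { _~_ = λ _ _ → ⊥ ; _~?_ = λ _ _ → no λ () ; ~-sym = λ () ; ~-irrefl = λ _ () }

singleNode-isTree : SimpleGraph.IsTree singleNode
singleNode-isTree = record
  { root      = zero
  ; connected = λ { zero zero → ε }
  ; acyclic   = λ { (_ , _ , _ , _ , _ , () ∷ _) }
  }

module _ {V : Set} (_≟_ : DecidableEquality V) (vs : List V) (complete : ∀ v → v ∈ vs)
         (G : SimpleGraph V) where

  trivialDecomposition : TreeDecomposition G
  trivialDecomposition = record
    { nodes          = 1
    ; tree           = singleNode
    ; isTree         = singleNode-isTree
    ; bag            = λ _ → deduplicate _≟_ vs
    ; bag-unique     = λ _ → UniqueDec.deduplicate-! _≟_ vs
    ; vertex-covered = λ v → zero , covered v
    ; edge-covered   = λ {u} {v} _ → zero , covered u , covered v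
    ; bags-connected = λ { v {zero} {zero} _ _ → ε }
    }
    where
    covered : ∀ v → v ∈ deduplicate _≟_ vs
    covered v = ∈-deduplicate⁺ _≟_ (complete v)

  ¬¬-hasTreewidth : ¬ ¬ ∃ (HasTreewidth G)
  ¬¬-hasTreewidth none = <-rec (λ w → (D : TreeDecomposition G) → ¬ width D ≡ w) step
    (width trivialDecomposition) trivialDecomposition refl
    where
    step : ∀ w → (∀ {v} → v < w → (D : TreeDecomposition G) → ¬ width D ≡ v) →
           (D : TreeDecomposition G) → ¬ width D ≡ w
    step w smaller D eq = none (w , record
      { attained = D , eq
      ; minimal  = λ D′ → ≮⇒≥ λ lt → smaller lt D′ refl
      })

infix 4 _≟ˢ_
_≟ˢ_ : ∀ {n k} → DecidableEquality (KSubset n k)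
(A , p) ≟ˢ (B , q) with Vec-≡-dec _≟ᵇ_ A B
... | no A≢B   = no λ e → A≢B (cong proj₁ e)
... | yes refl = yes (cong (A ,_) (≡ⁿ-irrelevant p q))

outside∷ : ∀ {n k} → KSubset n k → KSubset (suc n) k
outside∷ (A , p) = outside ∷ A , p

inside∷ : ∀ {n k} → KSubset n k → KSubset (suc n) (suc k)
inside∷ (A , p) = inside ∷ A , cong suc p

kSubsets : ∀ n k → List (KSubset n k)
kSubsets zero    zero    = [ [] , refl ]
kSubsets zero    (suc k) = []
kSubsets (suc n) zero    = map outside∷ (kSubsets n zero)
kSubsets (suc n) (suc k) = map outside∷ (kSubsets n (suc k)) ++ map inside∷ (kSubsets n k)

kSubsets-complete : ∀ n k (A : KSubset n k) → A ∈ kSubsets n k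
kSubsets-complete zero    zero    ([] , refl) = here refl
kSubsets-complete (suc n) zero    (outside ∷ A , p) =
  ∈-map⁺ outside∷ (kSubsets-complete n zero (A , p))
kSubsets-complete (suc n) (suc k) (outside ∷ A , p) =
  ∈-++⁺ˡ (∈-map⁺ outside∷ (kSubsets-complete n (suc k) (A , p)))
kSubsets-complete (suc n) (suc .(∣ A ∣)) (inside ∷ A , refl) =
  ∈-++⁺ʳ (map outside∷ (kSubsets n (suc ∣ A ∣)))
    (∈-map⁺ inside∷ (kSubsets-complete n ∣ A ∣ (A , refl)))

Johnson-¬¬-hasTreewidth : ∀ n k → ¬ ¬ ∃ (HasTreewidth (Johnson n k))
Johnson-¬¬-hasTreewidth n k =
  ¬¬-hasTreewidth _≟ˢ_ (kSubsets n k) (kSubsets-complete n k) (Johnson n k)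

BipartiteKneser-¬¬-hasTreewidth : ∀ n k → ¬ ¬ ∃ (HasTreewidth (BipartiteKneser n k))
BipartiteKneser-¬¬-hasTreewidth n k =
  ¬¬-hasTreewidth (⊎-≡-dec _≟ˢ_ _≟ˢ_)
    (map inj₁ (kSubsets n k) ++ map inj₂ (kSubsets n (n ∸ k))) complete (BipartiteKneser n k)
  where
  complete : ∀ v → v ∈ map inj₁ (kSubsets n k) ++ map inj₂ (kSubsets n (n ∸ k))
  complete (inj₁ A) = ∈-++⁺ˡ (∈-map⁺ inj₁ (kSubsets-complete n k A))
  complete (inj₂ B) = ∈-++⁺ʳ (map inj₁ (kSubsets n k))
    (∈-map⁺ inj₂ (kSubsets-complete n (n ∸ k) B))

{-# OPTIONS --safe #-}
module Submission where

-- Upper bounds. The trivial decomposition gives tw(J) ≤ C(n,k). The k-subsets of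
-- a (k+1)-set B form a clique of J, so some bag of a decomposition of J contains
-- all of them; a new leaf with bag {B} ∪ {k-subsets of B} attached there, for
-- each B, turns it into a decomposition of BK. The new bags have size k+2, which
-- is the size of a clique of J and hence at most tw(J)+1.
--
-- Lower bound. Deleting x k-sets and y (k+1)-sets so that no path of BK joins two
-- families of s and t remaining k-sets requires s t ≤ (s+t) n (x+y); this is
-- proved by splitting all sets according to one element of [n] and decomposing
-- a variance. If all bags had at most m < N/(10n) elements, N = C(n,k), then at
-- each node i of the tree any grouping of the branches would be very unbalanced,
-- so one branch would hold more than half of the k-sets. Following heavy branches
-- leads to an edge of the tree whose two sides both hold more than half.

open import Defs
open import Data.Empty using (⊥-elim) renaming (⊥ to Empty)
open import Data.Fin.Base using (Fin; zero; suc; toℕ; fromℕ<)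
open import Data.Fin.Properties using (injective⇒≤; toℕ<n; toℕ-fromℕ<; toℕ-injective)
  renaming (_≟_ to _≟ᶠ_; any? to ∃?)
open import Data.Fin.Subset using (Subset; ⊥; inside; outside; ∣_∣; _∩_; _⊆_; _⊂_)
  renaming (_∈_ to _∈ˢ_)
open import Data.Fin.Subset.Induction using (⊂-wellFounded)
open import Data.Fin.Subset.Properties
  using (out⊆; s⊆s; ⊆-refl; ∩-idem; drop-∷-⊆; p⊆q⇒∣p∣≤∣q∣; ∣⊥∣≡0)
open import Data.Integer.Base using (+_)
import Data.Integer.Base as ℤ
import Data.Integer.Properties as ℤ
open import Data.List.Base using (List; []; _∷_; _∷ʳ_; _++_; map; length; lookup)
import Data.List.Membership.DecPropositional as DecMembership
open import Data.List.Membership.Propositional using (_∈_; _∉_; find)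
open import Data.List.Membership.Propositional.Properties using (∈-lookup; ∈-map⁺; ∈-map⁻)
import Data.List.Membership.Setoid.Properties as Membershipˢ
open import Data.List.Properties using (length-map; length-++; map-++)
open import Data.List.Relation.Unary.All as All using (All; []; _∷_)
import Data.List.Relation.Unary.All.Properties as Allₚ
open import Data.List.Relation.Unary.All.Properties using (¬All⇒Any¬; ¬Any⇒All¬)
open import Data.List.Relation.Unary.AllPairs as AllPairs using (AllPairs; []; _∷_)
import Data.List.Relation.Unary.AllPairs.Properties as AllPairsₚ
open import Data.List.Relation.Unary.Any using (here; there)
open import Data.List.Relation.Unary.Linked using (Linked; [-]; _∷_)
import Data.List.Relation.Unary.Linked.Properties as Linkedₚ
open import Data.List.Relation.Unary.Unique.Propositional using (Unique)
import Data.List.Relation.Unary.Unique.Propositional.Properties as Uniqueₚ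
open import Data.Nat.Base using (ℕ; zero; suc; NonZero; >-nonZero; >-nonZero⁻¹; ≢-nonZero;
  _+_; _≤_; _∸_; _⊔_; z≤n; s≤s; s≤s⁻¹) renaming (_*_ to _*ℕ_; _<_ to _<ℕ_)
open import Data.Nat.Combinatorics using (_C_; nCk+nC[k+1]≡[n+1]C[k+1])
open import Data.Nat.Properties
open import Data.Nat.Tactic.RingSolver using (solve-∀)
open import Data.Product.Base using (Σ; ∃; _×_; _,_; proj₁; proj₂)
open import Data.Rational.Base using (ℚ; 0ℚ; 1ℚ; _<_; _*_; _/_; toℚᵘ) renaming (_≤_ to _≤ℚ_)
import Data.Rational.Properties as ℚ
open import Data.Rational.Properties using (toℚᵘ-cancel-≤; toℚᵘ-homo-*; toℚᵘ-fromℚᵘ; positive⁻¹)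
open import Data.Rational.Unnormalised.Base as ℚᵘ using (mkℚᵘ; *≤*)
import Data.Rational.Unnormalised.Properties as ℚᵘ
open import Data.Sum.Base using (_⊎_; inj₁; inj₂)
open import Data.Sum.Properties using (inj₁-injective; inj₂-injective) renaming (≡-dec to ⊎-≡-dec)
import Data.Vec.Base as Vec
open import Data.Vec.Base using ([]; _∷_) renaming (here to hereᵛ)
open import Data.Vec.Functional using (foldr)
open import Data.Vec.Properties
  using (lookup⇒[]=; []=⇒lookup; lookup∘tabulate; ∷-injectiveˡ; ∷-injectiveʳ)
open import Function.Base using (_∘_; case_of_)
open import Induction.WellFounded using (Acc; acc)
open import Level using (0ℓ)
open import Relation.Binary.Construct.Closure.ReflexiveTransitive
  using (Star; ε; _◅_; _◅◅_; gmap; reverse) renaming (map to Star-map)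
open import Relation.Binary.Core using (Rel)
open import Relation.Binary.Definitions using (DecidableEquality; tri<; tri≈; tri>)
open import Relation.Binary.PropositionalEquality hiding ([_])
open import Relation.Nullary.Decidable using (Dec; yes; no; does; dec-true)
open import Relation.Nullary.Negation using (¬_; contradiction)

-- Expansion between consecutive levels of the cube

-- Follows Pascal's recursion on the first element, so that splitting a sum by that element is
-- definitional.
levelSum : ∀ n k → (KSubset n k → ℕ) → ℕ
levelSum zero    zero    f = f ([] , refl)
levelSum zero    (suc k) f = 0
levelSum (suc n) zero    f = levelSum n zero (f ∘ outside∷)
levelSum (suc n) (suc k) f = levelSum n (suc k) (f ∘ outside∷) + levelSum n k (f ∘ inside∷)

levelSum-mono : ∀ n k {f g : KSubset n k → ℕ} → (∀ A → f A ≤ g A) → levelSum n k f ≤ levelSum n k g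
levelSum-mono zero    zero    f≤g = f≤g _
levelSum-mono zero    (suc k) f≤g = z≤n
levelSum-mono (suc n) zero    f≤g = levelSum-mono n zero (f≤g ∘ outside∷)
levelSum-mono (suc n) (suc k) f≤g =
  +-mono-≤ (levelSum-mono n (suc k) (f≤g ∘ outside∷)) (levelSum-mono n k (f≤g ∘ inside∷))

levelSum-+ : ∀ n k (f g : KSubset n k → ℕ) →
  levelSum n k (λ A → f A + g A) ≡ levelSum n k f + levelSum n k g
levelSum-+ zero    zero    f g = refl
levelSum-+ zero    (suc k) f g = refl
levelSum-+ (suc n) zero    f g = levelSum-+ n zero (f ∘ outside∷) (g ∘ outside∷)
levelSum-+ (suc n) (suc k) f g = trans
  (cong₂ _+_ (levelSum-+ n (suc k) (f ∘ outside∷) (g ∘ outside∷))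
             (levelSum-+ n k (f ∘ inside∷) (g ∘ inside∷)))
  (interchange (levelSum n (suc k) (f ∘ outside∷)) _ _ _)
  where
  interchange : ∀ a b c d → (a + b) + (c + d) ≡ (a + c) + (b + d)
  interchange = solve-∀

levelSum-1 : ∀ n k → levelSum n k (λ _ → 1) ≡ n C k
levelSum-1 zero    zero    = refl
levelSum-1 zero    (suc k) = refl
levelSum-1 (suc n) zero    = levelSum-1 n zero
levelSum-1 (suc n) (suc k) = trans (cong₂ _+_ (levelSum-1 n (suc k)) (levelSum-1 n k))
  (trans (+-comm (n C suc k) (n C k)) (nCk+nC[k+1]≡[n+1]C[k+1] n k))

levelSum-0 : ∀ n k → levelSum n k (λ _ → 0) ≡ 0
levelSum-0 zero    zero    = refl
levelSum-0 zero    (suc k) = refl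
levelSum-0 (suc n) zero    = levelSum-0 n zero
levelSum-0 (suc n) (suc k) = cong₂ _+_ (levelSum-0 n (suc k)) (levelSum-0 n k)

levelSum-empty : ∀ {n k} → n <ℕ k → (f : KSubset n k → ℕ) → levelSum n k f ≡ 0
levelSum-empty {zero}  {suc k} n<k       f = refl
levelSum-empty {suc n} {suc k} (s≤s n<k) f =
  cong₂ _+_ (levelSum-empty (m<n⇒m<1+n n<k) (f ∘ outside∷)) (levelSum-empty n<k (f ∘ inside∷))

infix 4 _⋖_
infixr 5 _∷_
-- The covering relation of the cube, built from the position of the added element so that it splits
-- in the same way as `levelSum`.
data _⋖_ : ∀ {n} → Subset n → Subset n → Set where
  add : ∀ {n} {A : Subset n} → outside ∷ A ⋖ inside ∷ A
  _∷_ : ∀ {n} {A B : Subset n} b → A ⋖ B → b ∷ A ⋖ b ∷ B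

-- Every k-set lies below d sets of the next level and every (k+1)-set above
-- k+1 sets; summing a pointwise inequality over all covering pairs gives this.
levelSum-⋖ : ∀ n k d → k + d ≡ n → {f f′ : KSubset n k → ℕ} {g g′ : KSubset n (suc k) → ℕ} →
  (∀ A B → proj₁ A ⋖ proj₁ B → f A + g B ≤ f′ A + g′ B) →
  d *ℕ levelSum n k f + suc k *ℕ levelSum n (suc k) g ≤
  d *ℕ levelSum n k f′ + suc k *ℕ levelSum n (suc k) g′
levelSum-⋖ zero zero d refl _ = z≤n
levelSum-⋖ (suc n) zero .(suc n) refl {f} {f′} {g} {g′} f+g≤f′+g′ =
  subst₂ _≤_ (regroup n (levelSum n 0 (f ∘ outside∷)) _ _)
             (regroup n (levelSum n 0 (f′ ∘ outside∷)) _ _)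
    (+-mono-≤
      (levelSum-⋖ n zero n refl λ A B A⋖B → f+g≤f′+g′ (outside∷ A) (outside∷ B) (outside ∷ A⋖B))
      (subst₂ _≤_ (levelSum-+ n 0 (f ∘ outside∷) (g ∘ inside∷))
                  (levelSum-+ n 0 (f′ ∘ outside∷) (g′ ∘ inside∷))
        (levelSum-mono n 0 λ A → f+g≤f′+g′ (outside∷ A) (inside∷ A) add)))
  where
  regroup : ∀ n a b c → (n *ℕ a + 1 *ℕ b) + (a + c) ≡ suc n *ℕ a + 1 *ℕ (b + c)
  regroup = solve-∀
-- With d = 0 the lower level consists of the whole set only, and the level above it is empty.
levelSum-⋖ (suc n) (suc k) zero k+0≡n {g = g} _ = ≤-trans (≤-reflexive lhs≡0) z≤n
  where
  lhs≡0 : suc (suc k) *ℕ levelSum (suc n) (suc (suc k)) g ≡ 0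
  lhs≡0 = trans
    (cong (suc (suc k) *ℕ_)
      (levelSum-empty (s≤s (≤-reflexive (trans (sym k+0≡n) (+-identityʳ (suc k))))) g))
    (*-zeroʳ (suc (suc k)))
levelSum-⋖ (suc n) (suc k) (suc d) k+d≡n {f} {f′} {g} {g′} f+g≤f′+g′ =
  subst₂ _≤_
    (regroup d k (levelSum n k (f ∘ inside∷)) _ (levelSum n (suc k) (f ∘ outside∷))
      (levelSum n (suc (suc k)) (g ∘ outside∷)))
    (regroup d k (levelSum n k (f′ ∘ inside∷)) _ (levelSum n (suc k) (f′ ∘ outside∷))
      (levelSum n (suc (suc k)) (g′ ∘ outside∷)))
    -- Covering pairs are split by the first element: it lies in both sets, in neither, or is the
    -- added one.
    (+-mono-≤ (+-mono-≤
      (levelSum-⋖ n k (suc d) (suc-injective k+d≡n)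
        λ A B A⋖B → f+g≤f′+g′ (inside∷ A) (inside∷ B) (inside ∷ A⋖B))
      (levelSum-⋖ n (suc k) d (suc-injective (trans (sym (cong suc (+-suc k d))) k+d≡n))
        λ A B A⋖B → f+g≤f′+g′ (outside∷ A) (outside∷ B) (outside ∷ A⋖B)))
      (subst₂ _≤_ (levelSum-+ n (suc k) (f ∘ outside∷) (g ∘ inside∷))
                  (levelSum-+ n (suc k) (f′ ∘ outside∷) (g′ ∘ inside∷))
        (levelSum-mono n (suc k) λ A → f+g≤f′+g′ (outside∷ A) (inside∷ A) add)))
  where
  regroup : ∀ d k a b c e →
    ((suc d *ℕ a + suc k *ℕ b) + (d *ℕ c + suc (suc k) *ℕ e)) + (c + b) ≡
    suc d *ℕ (c + a) + suc (suc k) *ℕ (e + b)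
  regroup = solve-∀

-- s and t are indicators of two families of k-sets, x and y of blocking families
-- of k-sets and (k+1)-sets: unblocked k-sets with a common unblocked upper cover
-- do not lie in different families. Only sums matter, so x and y may have
-- multiplicities.
record Separation {n k : ℕ} (s t x : KSubset n k → ℕ) (y : KSubset n (suc k) → ℕ) : Set where
  field
    disjoint   : ∀ A → s A *ℕ t A ≡ 0
    transfer-s : ∀ A A′ B → proj₁ A ⋖ proj₁ B → proj₁ A′ ⋖ proj₁ B → s A ≤ s A′ + x A′ + y B
    transfer-t : ∀ A A′ B → proj₁ A ⋖ proj₁ B → proj₁ A′ ⋖ proj₁ B → t A ≤ t A′ + x A′ + y B
open Separation

swap-sides : ∀ {n k} {s t x : KSubset n k → ℕ} {y} → Separation s t x y → Separation t s x y
swap-sides {s = s} {t} sep = record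
  { disjoint   = λ A → trans (*-comm (t A) (s A)) (disjoint sep A)
  ; transfer-s = transfer-t sep
  ; transfer-t = transfer-s sep
  }

restrict-outside : ∀ {n k} {s t x : KSubset (suc n) k → ℕ} {y} → Separation s t x y →
  Separation (s ∘ outside∷) (t ∘ outside∷) (x ∘ outside∷) (y ∘ outside∷)
restrict-outside sep = record
  { disjoint   = disjoint sep ∘ outside∷
  ; transfer-s = λ _ _ _ A⋖B A′⋖B → transfer-s sep _ _ _ (outside ∷ A⋖B) (outside ∷ A′⋖B)
  ; transfer-t = λ _ _ _ A⋖B A′⋖B → transfer-t sep _ _ _ (outside ∷ A⋖B) (outside ∷ A′⋖B)
  }

restrict-inside : ∀ {n k} {s t x : KSubset (suc n) (suc k) → ℕ} {y} → Separation s t x y →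
  Separation (s ∘ inside∷) (t ∘ inside∷) (x ∘ inside∷) (y ∘ inside∷)
restrict-inside sep = record
  { disjoint   = disjoint sep ∘ inside∷
  ; transfer-s = λ _ _ _ A⋖B A′⋖B → transfer-s sep _ _ _ (inside ∷ A⋖B) (inside ∷ A′⋖B)
  ; transfer-t = λ _ _ _ A⋖B A′⋖B → transfer-t sep _ _ _ (inside ∷ A⋖B) (inside ∷ A′⋖B)
  }

-- Chaining `s-up` with `t-down` turns s₁t₀ into s₀t₁, as d and e cancel in the main term. The
-- larger of d and e is divided out at the end, and the order of the chain is chosen so that the
-- smaller one survives only in error terms, where the larger bounds it.
cross-bound : ∀ d e s₁ s₀ t₁ t₀ x₁ x₀ y₁ → .{{NonZero e}} →
  d *ℕ s₁ ≤ e *ℕ (s₀ + x₀ + y₁) → e *ℕ s₀ ≤ d *ℕ (s₁ + x₁) + e *ℕ y₁ →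
  d *ℕ t₁ ≤ e *ℕ (t₀ + x₀ + y₁) → e *ℕ t₀ ≤ d *ℕ (t₁ + x₁) + e *ℕ y₁ →
  s₁ *ℕ t₀ ≤ s₀ *ℕ t₁ + ((s₁ + t₁) + (s₀ + t₀)) *ℕ (x₁ + x₀ + y₁)
cross-bound d e s₁ s₀ t₁ t₀ x₁ x₀ y₁ s-up s-down t-up t-down with ≤-total e d
... | inj₁ e≤d = *-cancelˡ-≤ d {{>-nonZero (≤-trans (>-nonZero⁻¹ e) e≤d)}} (begin
  d *ℕ (s₁ *ℕ t₀)                                       ≡⟨ sym (*-assoc d s₁ t₀) ⟩
  d *ℕ s₁ *ℕ t₀                                         ≤⟨ *-monoˡ-≤ t₀ s-up ⟩
  e *ℕ (s₀ + x₀ + y₁) *ℕ t₀                             ≡⟨ e₁ e s₀ x₀ y₁ t₀ ⟩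
  e *ℕ t₀ *ℕ s₀ + e *ℕ (t₀ *ℕ (x₀ + y₁))                ≤⟨ +-monoˡ-≤ _ (*-monoˡ-≤ s₀ t-down) ⟩
  (d *ℕ (t₁ + x₁) + e *ℕ y₁) *ℕ s₀ + e *ℕ (t₀ *ℕ (x₀ + y₁))
    ≤⟨ +-mono-≤ (*-monoˡ-≤ s₀ (+-monoʳ-≤ (d *ℕ (t₁ + x₁)) (*-monoˡ-≤ y₁ e≤d)))
                (*-monoˡ-≤ (t₀ *ℕ (x₀ + y₁)) e≤d) ⟩
  (d *ℕ (t₁ + x₁) + d *ℕ y₁) *ℕ s₀ + d *ℕ (t₀ *ℕ (x₀ + y₁))
    -- The added terms complete the product of all weights with x₁ + x₀ + y₁.
    ≤⟨ m≤m+n _ (d *ℕ (s₁ *ℕ (x₁ + x₀ + y₁) + t₁ *ℕ (x₁ + x₀ + y₁) + s₀ *ℕ x₀ + t₀ *ℕ x₁)) ⟩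
  (d *ℕ (t₁ + x₁) + d *ℕ y₁) *ℕ s₀ + d *ℕ (t₀ *ℕ (x₀ + y₁)) +
    d *ℕ (s₁ *ℕ (x₁ + x₀ + y₁) + t₁ *ℕ (x₁ + x₀ + y₁) + s₀ *ℕ x₀ + t₀ *ℕ x₁)
    ≡⟨ e₂ d s₁ s₀ t₁ t₀ x₁ x₀ y₁ ⟩
  d *ℕ (s₀ *ℕ t₁ + ((s₁ + t₁) + (s₀ + t₀)) *ℕ (x₁ + x₀ + y₁)) ∎)
  where
  open ≤-Reasoning
  e₁ : ∀ e s₀ x₀ y₁ t₀ → e *ℕ (s₀ + x₀ + y₁) *ℕ t₀ ≡ e *ℕ t₀ *ℕ s₀ + e *ℕ (t₀ *ℕ (x₀ + y₁))
  e₁ = solve-∀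
  e₂ : ∀ d s₁ s₀ t₁ t₀ x₁ x₀ y₁ →
    (d *ℕ (t₁ + x₁) + d *ℕ y₁) *ℕ s₀ + d *ℕ (t₀ *ℕ (x₀ + y₁)) +
    d *ℕ (s₁ *ℕ (x₁ + x₀ + y₁) + t₁ *ℕ (x₁ + x₀ + y₁) + s₀ *ℕ x₀ + t₀ *ℕ x₁) ≡
    d *ℕ (s₀ *ℕ t₁ + ((s₁ + t₁) + (s₀ + t₀)) *ℕ (x₁ + x₀ + y₁))
  e₂ = solve-∀
... | inj₂ d≤e = *-cancelˡ-≤ e (begin
  e *ℕ (s₁ *ℕ t₀)                                       ≡⟨ e₁ e s₁ t₀ ⟩
  e *ℕ t₀ *ℕ s₁                                         ≤⟨ *-monoˡ-≤ s₁ t-down ⟩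
  (d *ℕ (t₁ + x₁) + e *ℕ y₁) *ℕ s₁                      ≡⟨ e₂ d e t₁ x₁ y₁ s₁ ⟩
  d *ℕ s₁ *ℕ t₁ + (d *ℕ (x₁ *ℕ s₁) + e *ℕ (y₁ *ℕ s₁))
    ≤⟨ +-mono-≤ (*-monoˡ-≤ t₁ s-up) (+-monoˡ-≤ _ (*-monoˡ-≤ (x₁ *ℕ s₁) d≤e)) ⟩
  e *ℕ (s₀ + x₀ + y₁) *ℕ t₁ + (e *ℕ (x₁ *ℕ s₁) + e *ℕ (y₁ *ℕ s₁))
    ≤⟨ m≤m+n _ (e *ℕ ((s₀ + t₀) *ℕ (x₁ + x₀ + y₁) + s₁ *ℕ x₀ + t₁ *ℕ x₁)) ⟩
  e *ℕ (s₀ + x₀ + y₁) *ℕ t₁ + (e *ℕ (x₁ *ℕ s₁) + e *ℕ (y₁ *ℕ s₁)) +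
    e *ℕ ((s₀ + t₀) *ℕ (x₁ + x₀ + y₁) + s₁ *ℕ x₀ + t₁ *ℕ x₁)
    ≡⟨ e₃ e s₁ s₀ t₁ t₀ x₁ x₀ y₁ ⟩
  e *ℕ (s₀ *ℕ t₁ + ((s₁ + t₁) + (s₀ + t₀)) *ℕ (x₁ + x₀ + y₁)) ∎)
  where
  open ≤-Reasoning
  e₁ : ∀ e s t → e *ℕ (s *ℕ t) ≡ e *ℕ t *ℕ s
  e₁ = solve-∀
  e₂ : ∀ d e t₁ x₁ y₁ s₁ → (d *ℕ (t₁ + x₁) + e *ℕ y₁) *ℕ s₁ ≡
    d *ℕ s₁ *ℕ t₁ + (d *ℕ (x₁ *ℕ s₁) + e *ℕ (y₁ *ℕ s₁))
  e₂ = solve-∀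
  e₃ : ∀ e s₁ s₀ t₁ t₀ x₁ x₀ y₁ →
    e *ℕ (s₀ + x₀ + y₁) *ℕ t₁ + (e *ℕ (x₁ *ℕ s₁) + e *ℕ (y₁ *ℕ s₁)) +
    e *ℕ ((s₀ + t₀) *ℕ (x₁ + x₀ + y₁) + s₁ *ℕ x₀ + t₁ *ℕ x₁) ≡
    e *ℕ (s₀ *ℕ t₁ + ((s₁ + t₁) + (s₀ + t₀)) *ℕ (x₁ + x₀ + y₁))
  e₃ = solve-∀

module _ {n k : ℕ} {s t x : KSubset (suc n) (suc k) → ℕ} {y} (sep : Separation s t x y) where

  private
    Lₖ Lₖ₊₁ : (KSubset (suc n) (suc k) → ℕ) → ℕ
    Lₖ f = levelSum n k (f ∘ inside∷)
    Lₖ₊₁ f = levelSum n (suc k) (f ∘ outside∷)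
    y₁ : KSubset n (suc k) → ℕ
    y₁ = y ∘ inside∷

  -- For A ⋖ B the set `inside∷ B` covers both `inside∷ A` and `outside∷ B`. Summing the transfer
  -- between these two over all covering pairs compares the densities of s on the two halves;
  -- `transfer-down` is the other direction.
  transfer-up : ∀ d → k + d ≡ n → d *ℕ Lₖ s ≤ suc k *ℕ (Lₖ₊₁ s + Lₖ₊₁ x + levelSum n (suc k) y₁)
  transfer-up d k+d≡n = begin
    d *ℕ Lₖ s                                         ≤⟨ m≤m+n _ _ ⟩
    d *ℕ Lₖ s + suc k *ℕ levelSum n (suc k) (λ _ → 0)
      ≤⟨ levelSum-⋖ n k d k+d≡n {f′ = λ _ → 0} {g′ = λ B → s (outside∷ B) + x (outside∷ B) + y₁ B}
           (λ A B A⋖B → ≤-trans (≤-reflexive (+-identityʳ _))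
             (transfer-s sep _ _ (inside∷ B) (inside ∷ A⋖B) add)) ⟩
    d *ℕ levelSum n k (λ _ → 0) +
      suc k *ℕ levelSum n (suc k) (λ B → s (outside∷ B) + x (outside∷ B) + y₁ B)
      ≡⟨ cong₂ (λ a b → d *ℕ a + suc k *ℕ b) (levelSum-0 n k)
           (trans (levelSum-+ n (suc k) _ y₁)
             (cong (_+ levelSum n (suc k) y₁) (levelSum-+ n (suc k) (s ∘ outside∷) (x ∘ outside∷)))) ⟩
    d *ℕ 0 + suc k *ℕ (Lₖ₊₁ s + Lₖ₊₁ x + levelSum n (suc k) y₁)
      ≡⟨ cong (_+ suc k *ℕ (Lₖ₊₁ s + Lₖ₊₁ x + levelSum n (suc k) y₁)) (*-zeroʳ d) ⟩
    suc k *ℕ (Lₖ₊₁ s + Lₖ₊₁ x + levelSum n (suc k) y₁) ∎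
    where open ≤-Reasoning

  transfer-down : ∀ d → k + d ≡ n →
    suc k *ℕ Lₖ₊₁ s ≤ d *ℕ (Lₖ s + Lₖ x) + suc k *ℕ levelSum n (suc k) y₁
  transfer-down d k+d≡n = begin
    suc k *ℕ Lₖ₊₁ s                                       ≤⟨ m≤n+m _ (d *ℕ levelSum n k (λ _ → 0)) ⟩
    d *ℕ levelSum n k (λ _ → 0) + suc k *ℕ Lₖ₊₁ s
      ≤⟨ levelSum-⋖ n k d k+d≡n {f′ = λ A → s (inside∷ A) + x (inside∷ A)} {g′ = y₁}
           (λ A B A⋖B → transfer-s sep _ _ (inside∷ B) add (inside ∷ A⋖B)) ⟩
    d *ℕ levelSum n k (λ A → s (inside∷ A) + x (inside∷ A)) + suc k *ℕ levelSum n (suc k) y₁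
      ≡⟨ cong (λ a → d *ℕ a + suc k *ℕ levelSum n (suc k) y₁)
           (levelSum-+ n k (s ∘ inside∷) (x ∘ inside∷)) ⟩
    d *ℕ (Lₖ s + Lₖ x) + suc k *ℕ levelSum n (suc k) y₁ ∎
    where open ≤-Reasoning

cross-separation : ∀ {n k} {s t x : KSubset (suc n) (suc k) → ℕ} {y} → Separation s t x y →
  let s₁ = levelSum n k (s ∘ inside∷) ; s₀ = levelSum n (suc k) (s ∘ outside∷)
      t₁ = levelSum n k (t ∘ inside∷) ; t₀ = levelSum n (suc k) (t ∘ outside∷)
      x₁ = levelSum n k (x ∘ inside∷) ; x₀ = levelSum n (suc k) (x ∘ outside∷)
      y₁ = levelSum n (suc k) (y ∘ inside∷) in
  s₁ *ℕ t₀ ≤ s₀ *ℕ t₁ + ((s₁ + t₁) + (s₀ + t₀)) *ℕ (x₁ + x₀ + y₁)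
cross-separation {n} {k} {s} {t} {x} {y} sep with k ≤? n
... | yes k≤n = cross-bound (n ∸ k) (suc k) (levelSum n k (s ∘ inside∷)) _
                  (levelSum n k (t ∘ inside∷)) _ (levelSum n k (x ∘ inside∷)) _ _
    (transfer-up sep (n ∸ k) k+[n∸k]≡n) (transfer-down sep (n ∸ k) k+[n∸k]≡n)
    (transfer-up (swap-sides sep) (n ∸ k) k+[n∸k]≡n) (transfer-down (swap-sides sep) (n ∸ k) k+[n∸k]≡n)
  where
  k+[n∸k]≡n : k + (n ∸ k) ≡ n
  k+[n∸k]≡n = m+[n∸m]≡n k≤n
-- For k > n the level of k-sets is empty, so s₁ = 0.
... | no k≰n rewrite levelSum-empty (≰⇒> k≰n) (s ∘ inside∷) = z≤n

-- With w₁ = s₁ + t₁, w₀ = s₀ + t₀ and w = w₁ + w₀, the identity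
-- s t w₁ w₀ = w (s₁ t₁ w₀ + s₀ t₀ w₁) + (s₁ t₀ − s₀ t₁)²
-- decomposes the variance s t / w of a two-valued function into the variances
-- inside the two halves and the variance between them.
variance-step-ordered : ∀ n s₁ s₀ t₁ t₀ D₁ D₀ →
  .{{NonZero (s₁ + t₁)}} → .{{NonZero (s₀ + t₀)}} →
  s₁ *ℕ t₁ ≤ (s₁ + t₁) *ℕ (n *ℕ D₁) → s₀ *ℕ t₀ ≤ (s₀ + t₀) *ℕ (n *ℕ D₀) →
  s₁ *ℕ t₀ ≤ s₀ *ℕ t₁ →
  s₀ *ℕ t₁ ≤ s₁ *ℕ t₀ + ((s₁ + t₁) + (s₀ + t₀)) *ℕ (D₁ + D₀) →
  (s₁ + s₀) *ℕ (t₁ + t₀) ≤ ((s₁ + t₁) + (s₀ + t₀)) *ℕ (suc n *ℕ (D₁ + D₀))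
variance-step-ordered n s₁ s₀ t₁ t₀ D₁ D₀ half₁ half₀ p≤q cross =
  -- Adding 2pq to both sides lets the square of p - q be expanded without subtraction.
  *-cancelˡ-≤ (w₁ *ℕ w₀) {{m*n≢0 w₁ w₀}} (+-cancelʳ-≤ (2 *ℕ (p *ℕ q)) _ _ (begin
    w₁ *ℕ w₀ *ℕ ((s₁ + s₀) *ℕ (t₁ + t₀)) + 2 *ℕ (p *ℕ q)
      ≡⟨ decompose s₁ s₀ t₁ t₀ ⟩
    w *ℕ (s₁ *ℕ t₁ *ℕ w₀ + s₀ *ℕ t₀ *ℕ w₁) + (p *ℕ p + q *ℕ q)
      ≡⟨ cong (λ r → w *ℕ (s₁ *ℕ t₁ *ℕ w₀ + s₀ *ℕ t₀ *ℕ w₁) + (p *ℕ p + r *ℕ r)) (sym p+δ≡q) ⟩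
    w *ℕ (s₁ *ℕ t₁ *ℕ w₀ + s₀ *ℕ t₀ *ℕ w₁) + (p *ℕ p + (p + δ) *ℕ (p + δ))
      ≡⟨ cong (λ r → w *ℕ (s₁ *ℕ t₁ *ℕ w₀ + s₀ *ℕ t₀ *ℕ w₁) + r) (square p δ) ⟩
    w *ℕ (s₁ *ℕ t₁ *ℕ w₀ + s₀ *ℕ t₀ *ℕ w₁) + (δ *ℕ δ + 2 *ℕ (p *ℕ (p + δ)))
      ≡⟨ cong (λ r → w *ℕ (s₁ *ℕ t₁ *ℕ w₀ + s₀ *ℕ t₀ *ℕ w₁) + (δ *ℕ δ + 2 *ℕ (p *ℕ r))) p+δ≡q ⟩
    w *ℕ (s₁ *ℕ t₁ *ℕ w₀ + s₀ *ℕ t₀ *ℕ w₁) + (δ *ℕ δ + 2 *ℕ (p *ℕ q))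
      -- In δ² one factor is bounded by w₁w₀, which is cancelled, and the other by `cross`. This
      -- contributes one further copy of w(D₁ + D₀), hence `suc n`.
      ≤⟨ +-mono-≤ (*-monoʳ-≤ w (+-mono-≤ (*-monoˡ-≤ w₀ half₁) (*-monoˡ-≤ w₁ half₀)))
                  (+-monoˡ-≤ (2 *ℕ (p *ℕ q)) (*-mono-≤ δ≤w₁w₀ δ≤wD)) ⟩
    w *ℕ (w₁ *ℕ (n *ℕ D₁) *ℕ w₀ + w₀ *ℕ (n *ℕ D₀) *ℕ w₁) +
      (w₁ *ℕ w₀ *ℕ (w *ℕ (D₁ + D₀)) + 2 *ℕ (p *ℕ q))
      ≡⟨ collect n w₁ w₀ w D₁ D₀ (2 *ℕ (p *ℕ q)) ⟩
    w₁ *ℕ w₀ *ℕ (w *ℕ (suc n *ℕ (D₁ + D₀))) + 2 *ℕ (p *ℕ q) ∎))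
  where
  open ≤-Reasoning
  w₁ w₀ w p q δ : ℕ
  w₁ = s₁ + t₁
  w₀ = s₀ + t₀
  w = w₁ + w₀
  p = s₁ *ℕ t₀
  q = s₀ *ℕ t₁
  δ = q ∸ p
  p+δ≡q : p + δ ≡ q
  p+δ≡q = m+[n∸m]≡n p≤q
  δ≤w₁w₀ : δ ≤ w₁ *ℕ w₀
  δ≤w₁w₀ = ≤-trans (m∸n≤m q p) (≤-trans (≤-reflexive (*-comm s₀ t₁))
    (*-mono-≤ (m≤n+m t₁ s₁) (m≤m+n s₀ t₀)))
  δ≤wD : δ ≤ w *ℕ (D₁ + D₀)
  δ≤wD = +-cancelˡ-≤ p _ _ (≤-trans (≤-reflexive p+δ≡q) cross)
  decompose : ∀ s₁ s₀ t₁ t₀ →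
    (s₁ + t₁) *ℕ (s₀ + t₀) *ℕ ((s₁ + s₀) *ℕ (t₁ + t₀)) + 2 *ℕ (s₁ *ℕ t₀ *ℕ (s₀ *ℕ t₁)) ≡
    ((s₁ + t₁) + (s₀ + t₀)) *ℕ (s₁ *ℕ t₁ *ℕ (s₀ + t₀) + s₀ *ℕ t₀ *ℕ (s₁ + t₁)) +
    (s₁ *ℕ t₀ *ℕ (s₁ *ℕ t₀) + s₀ *ℕ t₁ *ℕ (s₀ *ℕ t₁))
  decompose = solve-∀
  square : ∀ p δ → p *ℕ p + (p + δ) *ℕ (p + δ) ≡ δ *ℕ δ + 2 *ℕ (p *ℕ (p + δ))
  square = solve-∀
  collect : ∀ n w₁ w₀ w D₁ D₀ r →
    w *ℕ (w₁ *ℕ (n *ℕ D₁) *ℕ w₀ + w₀ *ℕ (n *ℕ D₀) *ℕ w₁) + (w₁ *ℕ w₀ *ℕ (w *ℕ (D₁ + D₀)) + r) ≡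
    w₁ *ℕ w₀ *ℕ (w *ℕ (suc n *ℕ (D₁ + D₀))) + r
  collect = solve-∀

-- If one half carries no weight, the bound for the other half suffices. Otherwise exchanging s and
-- t reduces to the ordered case.
variance-step : ∀ n s₁ s₀ t₁ t₀ D₁ D₀ →
  s₁ *ℕ t₁ ≤ (s₁ + t₁) *ℕ (n *ℕ D₁) → s₀ *ℕ t₀ ≤ (s₀ + t₀) *ℕ (n *ℕ D₀) →
  s₁ *ℕ t₀ ≤ s₀ *ℕ t₁ + ((s₁ + t₁) + (s₀ + t₀)) *ℕ (D₁ + D₀) →
  s₀ *ℕ t₁ ≤ s₁ *ℕ t₀ + ((s₁ + t₁) + (s₀ + t₀)) *ℕ (D₁ + D₀) →
  (s₁ + s₀) *ℕ (t₁ + t₀) ≤ ((s₁ + t₁) + (s₀ + t₀)) *ℕ (suc n *ℕ (D₁ + D₀))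
variance-step n s₁ s₀ t₁ t₀ D₁ D₀ half₁ half₀ cross cross′
  with s₁ + t₁ ≟ 0 | s₀ + t₀ ≟ 0 | ≤-total (s₁ *ℕ t₀) (s₀ *ℕ t₁)
... | yes w₁≡0 | _ | _
    rewrite m+n≡0⇒m≡0 s₁ w₁≡0 | m+n≡0⇒n≡0 s₁ w₁≡0 =
  ≤-trans half₀ (*-monoʳ-≤ (s₀ + t₀) (*-mono-≤ (n≤1+n n) (m≤n+m D₀ D₁)))
... | no _ | yes w₀≡0 | _
    rewrite m+n≡0⇒m≡0 s₀ w₀≡0 | m+n≡0⇒n≡0 s₀ w₀≡0
          | +-identityʳ s₁ | +-identityʳ t₁ | +-identityʳ (s₁ + t₁) =
  ≤-trans half₁ (*-monoʳ-≤ (s₁ + t₁) (*-mono-≤ (n≤1+n n) (m≤m+n D₁ D₀)))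
... | no w₁≢0 | no w₀≢0 | inj₁ p≤q =
  variance-step-ordered n s₁ s₀ t₁ t₀ D₁ D₀ {{≢-nonZero w₁≢0}} {{≢-nonZero w₀≢0}}
    half₁ half₀ p≤q cross′
... | no w₁≢0 | no w₀≢0 | inj₂ q≤p
    rewrite *-comm (s₁ + s₀) (t₁ + t₀) | +-comm s₁ t₁ | +-comm s₀ t₀
          | *-comm s₁ t₁ | *-comm s₀ t₀ | *-comm s₁ t₀ | *-comm s₀ t₁ =
  variance-step-ordered n t₁ t₀ s₁ s₀ D₁ D₀ {{≢-nonZero w₁≢0}} {{≢-nonZero w₀≢0}}
    half₁ half₀ q≤p cross

-- Induction on n, splitting by the first element. Each split costs one more copy of the blocking
-- weight, which is where the factor n comes from.
expansion : ∀ n k {s t x : KSubset n k → ℕ} {y} → Separation s t x y →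
  levelSum n k s *ℕ levelSum n k t ≤
  (levelSum n k s + levelSum n k t) *ℕ (n *ℕ (levelSum n k x + levelSum n (suc k) y))
expansion zero    zero    sep = ≤-trans (≤-reflexive (disjoint sep _)) z≤n
expansion zero    (suc k) sep = z≤n
expansion (suc n) zero {s} {t} {x} {y} sep = ≤-trans (expansion n zero (restrict-outside sep))
  (*-monoʳ-≤ (levelSum n 0 (s ∘ outside∷) + levelSum n 0 (t ∘ outside∷))
    (*-mono-≤ (n≤1+n n) (+-monoʳ-≤ (levelSum n 0 (x ∘ outside∷)) (m≤m+n _ _))))
expansion (suc n) (suc k) {s} {t} {x} {y} sep = subst₂ _≤_
  (cong₂ _*ℕ_ (+-comm s₁ s₀) (+-comm t₁ t₀))
  (cong₂ (λ a b → a *ℕ (suc n *ℕ b)) (regroup s₁ t₁ s₀ t₀) (regroup x₁ y₁ x₀ y₀))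
  (variance-step n s₁ s₀ t₁ t₀ (x₁ + y₁) (x₀ + y₀)
    (expansion n k (restrict-inside sep))
    (expansion n (suc k) (restrict-outside sep))
    (≤-trans (cross-separation sep)
      (+-monoʳ-≤ (s₀ *ℕ t₁) (*-monoʳ-≤ ((s₁ + t₁) + (s₀ + t₀)) x₁+x₀+y₁≤D)))
    (subst₂ _≤_ (*-comm t₁ s₀)
      (cong₂ _+_ (*-comm t₀ s₁)
        (cong (_*ℕ ((x₁ + y₁) + (x₀ + y₀))) (cong₂ _+_ (+-comm t₁ s₁) (+-comm t₀ s₀))))
      (≤-trans (cross-separation (swap-sides sep))
        (+-monoʳ-≤ (t₀ *ℕ s₁) (*-monoʳ-≤ ((t₁ + s₁) + (t₀ + s₀)) x₁+x₀+y₁≤D)))))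
  where
  s₁ s₀ t₁ t₀ x₁ x₀ y₁ y₀ : ℕ
  s₁ = levelSum n k (s ∘ inside∷)
  s₀ = levelSum n (suc k) (s ∘ outside∷)
  t₁ = levelSum n k (t ∘ inside∷)
  t₀ = levelSum n (suc k) (t ∘ outside∷)
  x₁ = levelSum n k (x ∘ inside∷)
  x₀ = levelSum n (suc k) (x ∘ outside∷)
  y₁ = levelSum n (suc k) (y ∘ inside∷)
  y₀ = levelSum n (suc (suc k)) (y ∘ outside∷)
  regroup : ∀ a b c d → (a + b) + (c + d) ≡ (c + a) + (d + b)
  regroup = solve-∀
  split : ∀ a b c d → a + b + c + d ≡ (a + c) + (b + d)
  split = solve-∀
  x₁+x₀+y₁≤D : x₁ + x₀ + y₁ ≤ (x₁ + y₁) + (x₀ + y₀)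
  x₁+x₀+y₁≤D = ≤-trans (m≤m+n _ y₀) (≤-reflexive (split x₁ x₀ y₁ y₀))

-- Trees and tree decompositions

-- Walks of this relation are walks in the graph with i deleted, except that the empty walk at i
-- also counts; hence the separate hypotheses of the form a ≢ i.
Avoiding : {V : Set} → Rel V 0ℓ → V → Rel V 0ℓ
Avoiding R i a b = R a b × a ≢ i × b ≢ i

data Path {V : Set} (R : Rel V 0ℓ) : V → V → List V → Set where
  stop : ∀ a → Path R a a (a ∷ [])
  _∷_ : ∀ {a b c l} → R a b → Path R b c l → Path R a c (a ∷ l)

module _ {V : Set} (_≟ⱽ_ : DecidableEquality V) where

  open DecMembership _≟ⱽ_ using (_∈?_)

  module _ {R : Rel V 0ℓ} where

    -- The recursion treats the end of the walk first, so the first occurrence of i that it meets is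
    -- the last visit.
    last-exit : ∀ {i v h} → Star R v h → h ≢ i →
      (v ≢ i × Star (Avoiding R i) v h) ⊎ (∃ λ c → R i c × c ≢ i × Star (Avoiding R i) c h)
    last-exit ε h≢i = inj₁ (h≢i , ε)
    last-exit {i} {v} (r ◅ w) h≢i with last-exit w h≢i | v ≟ⱽ i
    ... | inj₂ exit        | _        = inj₂ exit
    ... | inj₁ (b≢i , w′)  | yes refl = inj₂ (_ , r , b≢i , w′)
    ... | inj₁ (b≢i , w′)  | no v≢i   = inj₁ (v≢i , (r , v≢i , b≢i) ◅ w′)

    exit : ∀ {i h} → Star R i h → h ≢ i → ∃ λ c → R i c × c ≢ i × Star (Avoiding R i) c h
    exit w h≢i with last-exit w h≢i
    ... | inj₁ (i≢i , _) = contradiction refl i≢i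
    ... | inj₂ e         = e

    avoid-or-visit : ∀ i {v h} → Star R v h → Star (Avoiding R i) v h ⊎ Star R i h
    avoid-or-visit i ε = inj₁ ε
    avoid-or-visit i {v} (_◅_ {j = b} r w) with v ≟ⱽ i | b ≟ⱽ i | avoid-or-visit i w
    ... | yes refl | _        | _       = inj₂ (r ◅ w)
    ... | no _     | yes refl | _       = inj₂ w
    ... | no _     | no _     | inj₂ w′ = inj₂ w′
    ... | no v≢i   | no b≢i   | inj₁ w′ = inj₁ ((r , v≢i , b≢i) ◅ w′)

    path-suffix : ∀ {a b c l} → Path R a c l → Unique l → b ∈ l →
      ∃ λ l′ → Path R b c l′ × Unique l′
    path-suffix (stop _)   u         (here refl) = _ , (stop _) , u
    path-suffix (r ∷ p) u         (here refl) = _ , r ∷ p , u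
    path-suffix (_ ∷ p) (_ ∷ u)   (there b∈l) = path-suffix p u b∈l

    -- When a occurs again on the erased rest of the walk, everything before that occurrence is
    -- dropped.
    loop-erase : ∀ {a b} → Star R a b → ∃ λ l → Path R a b l × Unique l
    loop-erase ε = _ , stop _ , [] ∷ []
    loop-erase {a} (r ◅ w) with loop-erase w
    ... | l , p , u with a ∈? l
    ...   | yes a∈l = path-suffix p u a∈l
    ...   | no a∉l  = a ∷ l , r ∷ p , ¬Any⇒All¬ l a∉l ∷ u

  module _ (T : SimpleGraph V) where
    open SimpleGraph T

    avoiding-path : ∀ {i a b l} → a ≢ i → Path (Avoiding _~_ i) a b l → All (i ≢_) l
    avoiding-path a≢i (stop _)                 = (a≢i ∘ sym) ∷ []
    avoiding-path a≢i ((_ , _ , b≢i) ∷ p) = (a≢i ∘ sym) ∷ avoiding-path b≢i p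

    close-path : ∀ {i a b l} → Path (Avoiding _~_ i) a b l → b ~ i → Linked _~_ (l ∷ʳ i)
    close-path (stop _)                       b~i = b~i ∷ [-]
    close-path ((r , _) ∷ stop _)          b~i = r ∷ b~i ∷ [-]
    close-path ((r , _) ∷ p@(_ ∷ _))      b~i = r ∷ close-path p b~i

    -- As a ≢ b, the path has at least two vertices, which with i make the three that `Cycle`
    -- demands. The last two clauses differ only in how they expose these two entries of l.
    path⇒cycle : ∀ {i a b l} → i ~ a → i ~ b → a ≢ b → a ≢ i →
      Path (Avoiding _~_ i) a b l → Unique l → Cycle
    path⇒cycle _ _ a≢b _ (stop _) _ = contradiction refl a≢b
    path⇒cycle i~a i~b _ a≢i p@(_ ∷ stop _) u =
      _ , _ , _ , _ , avoiding-path a≢i p ∷ u , i~a ∷ close-path p (~-sym i~b)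
    path⇒cycle i~a i~b _ a≢i p@(_ ∷ _ ∷ _) u =
      _ , _ , _ , _ , avoiding-path a≢i p ∷ u , i~a ∷ close-path p (~-sym i~b)

    acyclic⇒neighbours-separated : ¬ Cycle → ∀ {i a b} → i ~ a → i ~ b →
      Star (Avoiding _~_ i) a b → a ≡ b
    acyclic⇒neighbours-separated acyclic {i} {a} {b} i~a i~b w with a ≟ⱽ b | loop-erase w
    ... | yes a≡b | _         = a≡b
    ... | no a≢b  | l , p , u =
      contradiction (path⇒cycle i~a i~b a≢b (λ a≡i → ~-irrefl (sym a≡i) i~a) p u) acyclic

-- Branches of a tree at a node

module Tree {m : ℕ} (T : SimpleGraph (Fin m)) (isTree : SimpleGraph.IsTree T) where
  open SimpleGraph T
  open SimpleGraph.IsTree isTree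

  ~⇒≢ : ∀ {i j} → i ~ j → i ≢ j
  ~⇒≢ i~j i≡j = ~-irrefl i≡j i~j

  Avoiding-reverse : ∀ {i a b} → Star (Avoiding _~_ i) a b → Star (Avoiding _~_ i) b a
  Avoiding-reverse = reverse λ (r , a≢i , b≢i) → ~-sym r , b≢i , a≢i

  -- The components of the tree without i, each named by the neighbour of i that it contains.
  Branch : Fin m → Fin m → Fin m → Set
  Branch i c h = i ~ c × Star (Avoiding _~_ i) c h

  branch⇒≢ : ∀ {i c h} → Branch i c h → h ≢ i
  branch⇒≢ (i~c , w) = go w (~⇒≢ i~c ∘ sym)
    where
    go : ∀ {i c h} → Star (Avoiding _~_ i) c h → c ≢ i → h ≢ i
    go ε                     c≢i = c≢i
    go ((_ , _ , b≢i) ◅ w) _   = go w b≢i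

  branch-exists : ∀ {i h} → h ≢ i → ∃ λ c → Branch i c h
  branch-exists {i} {h} h≢i with exit _≟ᶠ_ (connected i h) h≢i
  ... | c , i~c , _ , w = c , i~c , w

  branch-unique : ∀ {i c c′ h} → Branch i c h → Branch i c′ h → c ≡ c′
  branch-unique (i~c , w) (i~c′ , w′) =
    acyclic⇒neighbours-separated _≟ᶠ_ T acyclic i~c i~c′ (w ◅◅ Avoiding-reverse w′)

  -- Decided by comparing c with the one branch that contains h, so no search for walks is needed.
  branch? : ∀ i c h → Dec (Branch i c h)
  branch? i c h with h ≟ᶠ i
  ... | yes h≡i = no λ b → branch⇒≢ b h≡i
  ... | no h≢i with branch-exists h≢i
  ...   | c′ , b′ with c′ ≟ᶠ c
  ...     | yes refl = yes b′
  ...     | no c′≢c  = no λ b → c′≢c (branch-unique b′ b)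

  -- The walk from j to h avoids i, so its last exit from j goes to a neighbour other than i; then h
  -- would lie in two branches at j.
  opposite-branches : ∀ {i j h} → Branch i j h → ¬ Branch j i h
  opposite-branches {i} {j} (i~j , w) b with exit _≟ᶠ_ w (branch⇒≢ b)
  ... | c , (j~c , _ , c≢i) , _ , w′ =
    c≢i (branch-unique (j~c , Star-map (λ ((r , _) , avoids) → r , avoids) w′) b)

  -- If the walk from c to h visited i, its remainder would put h into the branch of j through i as
  -- well.
  other-branch : ∀ {i j c h} → i ~ j → Branch j c h → c ≢ i → Branch i j h
  other-branch {i} i~j b@(j~c , w) c≢i with avoid-or-visit _≟ᶠ_ i w
  ... | inj₁ w′ = i~j ,
    (j~c , ~⇒≢ i~j ∘ sym , c≢i) ◅ Star-map (λ ((r , _) , avoids) → r , avoids) w′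
  ... | inj₂ w′ = contradiction (branch-unique b (~-sym i~j , w′)) c≢i

  module _ (σ : Fin m → Fin m) (~σ : ∀ i → i ~ σ i) where

    -- Encoded as a `Subset` because strict inclusion of these is well-founded.
    σ-branch : Fin m → Subset m
    σ-branch i = Vec.tabulate λ h → does (branch? i (σ i) h)

    ∈-σ-branch⁺ : ∀ {i h} → Branch i (σ i) h → h ∈ˢ σ-branch i
    ∈-σ-branch⁺ {i} {h} b = lookup⇒[]= h (σ-branch i)
      (trans (lookup∘tabulate _ h) (dec-true (branch? i (σ i) h) b))

    ∈-σ-branch⁻ : ∀ {i h} → h ∈ˢ σ-branch i → Branch i (σ i) h
    ∈-σ-branch⁻ {i} {h} h∈ with branch? i (σ i) h | trans (sym (lookup∘tabulate _ h)) ([]=⇒lookup h∈)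
    ... | yes b | _  = b
    ... | no _  | ()

    -- Without a reversed pair the branches chosen along the orbit of σ would
    -- decrease strictly.
    reversed-edge : Fin m → ∃ λ i → σ (σ i) ≡ i
    reversed-edge i = search i (⊂-wellFounded (σ-branch i))
      where
      search : ∀ i → Acc _⊂_ (σ-branch i) → ∃ λ i → σ (σ i) ≡ i
      search i (acc rec) with σ (σ i) ≟ᶠ i
      ... | yes σσi≡i = i , σσi≡i
      -- The next branch lies inside the present one by `other-branch`; the node σ i belongs only to
      -- the present one.
      ... | no σσi≢i  = search (σ i) (rec
        ( (λ h∈ → ∈-σ-branch⁺ (other-branch (~σ i) (∈-σ-branch⁻ h∈) σσi≢i))
        , σ i , ∈-σ-branch⁺ (~σ i , ε) , λ σi∈ → branch⇒≢ (∈-σ-branch⁻ σi∈) refl))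

  -- The principle shared by the clique lemma and the lower bound: if every node points to a
  -- neighbour, two neighbours point to each other.
  mutual-choice : {P : Fin m → Fin m → Set} → (∀ i → ∃ (P i)) → (∀ {i c} → P i c → i ~ c) →
    Fin m → ∃ λ i → ∃ λ j → P i j × P j i
  mutual-choice {P} choose P⇒~ root with reversed-edge (proj₁ ∘ choose) (P⇒~ ∘ proj₂ ∘ choose) root
  ... | i , σσi≡i = i , proj₁ (choose i) , proj₂ (choose i) ,
    subst (P (proj₁ (choose i))) σσi≡i (proj₂ (choose (proj₁ (choose i))))

unique⇒lookup-injective : {V : Set} {xs : List V} → Unique xs →
  ∀ i j → lookup xs i ≡ lookup xs j → i ≡ j
unique⇒lookup-injective (_  ∷ _) zero    zero    _  = refl
unique⇒lookup-injective (x∉ ∷ _) zero    (suc j) eq =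
  contradiction eq (All.lookup x∉ (∈-lookup j))
unique⇒lookup-injective (x∉ ∷ _) (suc i) zero    eq =
  contradiction (sym eq) (All.lookup x∉ (∈-lookup i))
unique⇒lookup-injective (_  ∷ u) (suc i) (suc j) eq = cong suc (unique⇒lookup-injective u i j eq)

-- Sending a position of xs to the position of its entry in ys is injective.
unique-⊆⇒length≤ : {V : Set} {xs ys : List V} → Unique xs → All (_∈ ys) xs → length xs ≤ length ys
unique-⊆⇒length≤ {xs = xs} u xs⊆ys = injective⇒≤ λ {i} {j} eq →
  unique⇒lookup-injective u i j (Membershipˢ.index-injective (setoid _)
    (All.lookup xs⊆ys (∈-lookup i)) (All.lookup xs⊆ys (∈-lookup j)) eq)

-- Vertices on the sides of a bag

module Decomposition {V : Set} (_≟ⱽ_ : DecidableEquality V) {G : SimpleGraph V}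
                     (D : TreeDecomposition G) where
  open TreeDecomposition D
  open SimpleGraph tree using () renaming (_~_ to _~ᵀ_)
  open Tree tree isTree
  open DecMembership _≟ⱽ_ using (_∈?_)

  -- Only one bag containing v is mentioned; by `side-branch` all of them lie in the same branch.
  Side : Fin nodes → Fin nodes → V → Set
  Side i c v = v ∉ bag i × ∃ λ h → v ∈ bag h × Branch i c h

  -- The nodes whose bags contain v are joined by walks through such nodes, and i is not among them.
  side-branch : ∀ {i c v h} → Side i c v → v ∈ bag h → Branch i c h
  side-branch {v = v} (v∉bag , h′ , v∈bag , i~c , w) v∈bag′ = i~c ,
    w ◅◅ Star-map (λ (r , v∈a , v∈b) → r , outside-bag v∈a , outside-bag v∈b)
                  (bags-connected v v∈bag v∈bag′)
    where
    outside-bag : ∀ {a} → v ∈ bag a → a ≢ _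
    outside-bag v∈a refl = v∉bag v∈a

  side-exists : ∀ {i v} → v ∉ bag i → ∃ λ c → Side i c v
  side-exists {i} {v} v∉bag with vertex-covered v
  ... | h , v∈bag with branch-exists {i} {h} (λ { refl → v∉bag v∈bag })
  ...   | c , b = c , v∉bag , h , v∈bag , b

  side-~ᵀ : ∀ {i c v} → Side i c v → i ~ᵀ c
  side-~ᵀ (_ , _ , _ , i~c , _) = i~c

  side-unique : ∀ {i c c′ v} → Side i c v → Side i c′ v → c ≡ c′
  side-unique s (_ , _ , v∈bag , b) = branch-unique (side-branch s v∈bag) b

  side-transfer : ∀ {i c u v h} → Side i c u → v ∉ bag i → u ∈ bag h → v ∈ bag h → Side i c v
  side-transfer s v∉bag u∈bag v∈bag = v∉bag , _ , v∈bag , side-branch s u∈bag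

  opposite-sides : ∀ {i j u v h} → Side i j u → Side j i v → u ∈ bag h → ¬ v ∈ bag h
  opposite-sides s s′ u∈bag v∈bag = opposite-branches (side-branch s u∈bag) (side-branch s′ v∈bag)

  missed-side : (K : List V) → ∀ i → ¬ All (_∈ bag i) K → ∃ λ c → ∃ λ v → v ∈ K × Side i c v
  missed-side K i not-all with find (¬All⇒Any¬ (_∈? bag i) K not-all)
  ... | v , v∈K , v∉bag with side-exists v∉bag
  ...   | c , s = c , v , v∈K , s

  -- If every bag missed a member of K, then K minus the bag of i would lie in
  -- one branch at i; but two opposite branches have no node in common.
  clique⊆bag : (K : List V) → (∀ {u v} → u ∈ K → v ∈ K → ∃ λ h → u ∈ bag h × v ∈ bag h) →
    ∃ λ i → All (_∈ bag i) K
  clique⊆bag K share with ∃? (λ i → All.all? (_∈? bag i) K)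
  ... | yes found = found
  ... | no none = ⊥-elim (not-mutual (mutual-choice (λ i → missed-side K i (λ all → none (i , all)))
                    (λ (_ , _ , s) → side-~ᵀ s) (SimpleGraph.IsTree.root isTree)))
    where
    not-mutual : ¬ (∃ λ i → ∃ λ j → (∃ λ v → v ∈ K × Side i j v) × (∃ λ v → v ∈ K × Side j i v))
    not-mutual (i , j , (u , u∈K , s) , (v , v∈K , s′)) =
      let _ , u∈bag , v∈bag = share u∈K v∈K in opposite-sides s s′ u∈bag v∈bag

-- The lower bound

𝟙 : {P : Set} → Dec P → ℕ
𝟙 (yes _) = 1
𝟙 (no _)  = 0

𝟙≤1 : ∀ {P} (P? : Dec P) → 𝟙 P? ≤ 1
𝟙≤1 (yes _) = ≤-refl
𝟙≤1 (no _)  = z≤n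

𝟙-≤ : ∀ {P r} (P? : Dec P) → (P → 1 ≤ r) → 𝟙 P? ≤ r
𝟙-≤ (yes p) 1≤r = 1≤r p
𝟙-≤ (no _)  _   = z≤n

𝟙-true : ∀ {P} (P? : Dec P) → P → 1 ≤ 𝟙 P?
𝟙-true (yes _) _ = ≤-refl
𝟙-true (no ¬p) p = contradiction p ¬p

𝟙-false : ∀ {P} (P? : Dec P) → ¬ P → 𝟙 P? ≤ 0
𝟙-false (yes p) ¬p = contradiction p ¬p
𝟙-false (no _)  _  = z≤n

𝟙-disjoint : ∀ {P Q} (P? : Dec P) (Q? : Dec Q) → ¬ (P × Q) → 𝟙 P? + 𝟙 Q? ≤ 1
𝟙-disjoint (yes p) Q?      ¬pq = +-monoʳ-≤ 1 (𝟙-false Q? (λ q → ¬pq (p , q)))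
𝟙-disjoint (no _)  Q?      _   = 𝟙≤1 Q?

𝟙-*-disjoint : ∀ {P Q} (P? : Dec P) (Q? : Dec Q) → ¬ (P × Q) → 𝟙 P? *ℕ 𝟙 Q? ≡ 0
𝟙-*-disjoint (yes p) (yes q) ¬pq = contradiction (p , q) ¬pq
𝟙-*-disjoint (yes _) (no _)  _   = refl
𝟙-*-disjoint (no _)  Q?      _   = refl

levelSum-zero : ∀ n k {f : KSubset n k → ℕ} → (∀ A → f A ≤ 0) → levelSum n k f ≤ 0
levelSum-zero n k f≤0 = ≤-trans (levelSum-mono n k f≤0) (≤-reflexive (levelSum-0 n k))

KSubset-≡ : ∀ {n k} {A B : KSubset n k} → proj₁ A ≡ proj₁ B → A ≡ B
KSubset-≡ {A = A , p} {_ , q} refl = cong (A ,_) (≡-irrelevant p q)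

-- `A₀` carries no size, so the recursion can strip its first entry freely.
levelSum-singleton : ∀ n k (A₀ : Subset n) {P : KSubset n k → Set} (P? : ∀ A → Dec (P A)) →
  (∀ A → P A → A₀ ≡ proj₁ A) → levelSum n k (λ A → 𝟙 (P? A)) ≤ 1
levelSum-singleton zero    zero    A₀ P? _ = 𝟙≤1 (P? _)
levelSum-singleton zero    (suc k) A₀ P? _ = z≤n
levelSum-singleton (suc n) zero    (b ∷ A₀) P? only =
  levelSum-singleton n zero A₀ (P? ∘ outside∷) λ A p → ∷-injectiveʳ (only _ p)
levelSum-singleton (suc n) (suc k) (outside ∷ A₀) P? only = +-mono-≤
  (levelSum-singleton n (suc k) A₀ (P? ∘ outside∷) λ A p → ∷-injectiveʳ (only _ p))
  (levelSum-zero n k λ A → 𝟙-false (P? (inside∷ A)) λ p → case (∷-injectiveˡ (only _ p)) of λ ())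
levelSum-singleton (suc n) (suc k) (inside ∷ A₀) P? only = +-mono-≤
  (levelSum-zero n (suc k) λ A → 𝟙-false (P? (outside∷ A)) λ p → case (∷-injectiveˡ (only _ p)) of λ ())
  (levelSum-singleton n k A₀ (P? ∘ inside∷) λ A p → ∷-injectiveʳ (only _ p))

⋖⇒⊆ : ∀ {n} {A B : Subset n} → A ⋖ B → A ⊆ B
⋖⇒⊆ add       = out⊆ ⊆-refl
⋖⇒⊆ (_ ∷ A⋖B) = s⊆s (⋖⇒⊆ A⋖B)

-- A discrete intermediate value principle, used to find the threshold at which the balance between
-- two groups of branches turns.
crossing : {P Q : ℕ → Set} → (∀ c → P c ⊎ Q c) → ∀ n → P 0 → Q (suc n) →
  ∃ λ c → c <ℕ suc n × P c × Q (suc c)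
crossing P⊎Q zero    p q = 0 , ≤-refl , p , q
crossing P⊎Q (suc n) p q with P⊎Q (suc n)
... | inj₁ p′ = suc n , ≤-refl , p′ , q
... | inj₂ q′ with crossing P⊎Q n p q′
...   | c , c<n , found = c , m<n⇒m<1+n c<n , found

smaller-side : ∀ s t M → s *ℕ t ≤ (s + t) *ℕ M → s ≤ t → s ≤ 2 *ℕ M
smaller-side s zero      M st≤ s≤0 = ≤-trans s≤0 z≤n
smaller-side s t@(suc _) M st≤ s≤t = *-cancelʳ-≤ s (2 *ℕ M) t (begin
  s *ℕ t          ≤⟨ st≤ ⟩
  (s + t) *ℕ M    ≤⟨ *-monoˡ-≤ M (+-monoˡ-≤ t s≤t) ⟩
  (t + t) *ℕ M    ≡⟨ double t M ⟩
  2 *ℕ M *ℕ t     ∎)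
  where
  open ≤-Reasoning
  double : ∀ t M → (t + t) *ℕ M ≡ 2 *ℕ M *ℕ t
  double = solve-∀

module LowerBound {n k : ℕ} (n∸k≡k+1 : n ∸ k ≡ suc k) where

  V : Set
  V = BKVertex n k

  _≟ⱽ_ : DecidableEquality V
  _≟ⱽ_ = ⊎-≡-dec _≟ˢ_ _≟ˢ_

  -- The second part of BK consists of (n-k)-sets, which are the (k+1)-sets because n - k = k + 1.
  upper : KSubset n (suc k) → V
  upper (B , p) = inj₂ (B , trans p (sym n∸k≡k+1))

  -- Multiplicities in a bag serve as the blocking functions of `Separation`. Being additive along
  -- the list, they sum to at most its length.
  occurrences : List V → V → ℕ
  occurrences []       v = 0
  occurrences (u ∷ us) v = 𝟙 (u ≟ⱽ v) + occurrences us v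

  ∈⇒occurs : ∀ {us v} → v ∈ us → 1 ≤ occurrences us v
  ∈⇒occurs {u ∷ us} {v} (here v≡u)   = ≤-trans (𝟙-true (u ≟ⱽ v) (sym v≡u)) (m≤m+n _ _)
  ∈⇒occurs {u ∷ us} {v} (there v∈us) = ≤-trans (∈⇒occurs v∈us) (m≤n+m _ (𝟙 (u ≟ⱽ v)))

  occurs-once : ∀ u → levelSum n k (λ A → 𝟙 (u ≟ⱽ inj₁ A)) +
                      levelSum n (suc k) (λ B → 𝟙 (u ≟ⱽ upper B)) ≤ 1
  occurs-once (inj₁ A₀) = +-mono-≤
    (levelSum-singleton n k (proj₁ A₀) (λ A → inj₁ A₀ ≟ⱽ inj₁ A) λ A eq → cong proj₁ (inj₁-injective eq))
    (levelSum-zero n (suc k) λ B → 𝟙-false (inj₁ A₀ ≟ⱽ upper B) λ ())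
  occurs-once (inj₂ B₀) = +-mono-≤
    (levelSum-zero n k λ A → 𝟙-false (inj₂ B₀ ≟ⱽ inj₁ A) λ ())
    (levelSum-singleton n (suc k) (proj₁ B₀) (λ B → inj₂ B₀ ≟ⱽ upper B) λ B eq → cong proj₁ (inj₂-injective eq))

  Σ-occurrences≤length : ∀ us → levelSum n k (occurrences us ∘ inj₁) +
                                levelSum n (suc k) (occurrences us ∘ upper) ≤ length us
  Σ-occurrences≤length []       = ≤-reflexive (cong₂ _+_ (levelSum-0 n k) (levelSum-0 n (suc k)))
  Σ-occurrences≤length (u ∷ us) = begin
    levelSum n k (occurrences (u ∷ us) ∘ inj₁) + levelSum n (suc k) (occurrences (u ∷ us) ∘ upper)
      ≡⟨ cong₂ _+_ (levelSum-+ n k (λ A → 𝟙 (u ≟ⱽ inj₁ A)) (occurrences us ∘ inj₁))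
                   (levelSum-+ n (suc k) (λ B → 𝟙 (u ≟ⱽ upper B)) (occurrences us ∘ upper)) ⟩
    (a + b) + (c + d)   ≡⟨ interchange a b c d ⟩
    (a + c) + (b + d)   ≤⟨ +-mono-≤ (occurs-once u) (Σ-occurrences≤length us) ⟩
    suc (length us)     ∎
    where
    open ≤-Reasoning
    a b c d : ℕ
    a = levelSum n k (λ A → 𝟙 (u ≟ⱽ inj₁ A))
    b = levelSum n k (occurrences us ∘ inj₁)
    c = levelSum n (suc k) (λ B → 𝟙 (u ≟ⱽ upper B))
    d = levelSum n (suc k) (occurrences us ∘ upper)
    interchange : ∀ a b c d → (a + b) + (c + d) ≡ (a + c) + (b + d)
    interchange = solve-∀

  module _ (D : TreeDecomposition (BipartiteKneser n k)) {m : ℕ}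
           (bag≤m : ∀ i → length (TreeDecomposition.bag D i) ≤ m) where
    open TreeDecomposition D
    open SimpleGraph tree using () renaming (_~_ to _~ᵀ_; _~?_ to _~ᵀ?_)
    open Decomposition _≟ⱽ_ D
    open DecMembership _≟ⱽ_ using (_∈?_)

    private
      N M : ℕ
      N = n C k
      M = n *ℕ m

    -- A decidable set of nodes; at a node i it stands for the group of branches named by its
    -- members. Groups are cut off by the numbering of the nodes.
    Selection : Set₁
    Selection = Σ (Fin nodes → Set) λ Q → ∀ j → Dec (Q j)

    low high : ℕ → Selection
    low c  = (λ j → toℕ j <ℕ c) , λ j → toℕ j <? c
    high c = (λ j → c ≤ toℕ j) , λ j → c ≤? toℕ j

    only : Fin nodes → Selection
    only c = (c ≡_) , (c ≟ᶠ_)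

    InSides : Selection → Fin nodes → V → Set
    InSides Q i v = ∃ λ j → proj₁ Q j × Side i j v

    inSides? : ∀ Q i v → Dec (InSides Q i v)
    inSides? Q i v with v ∈? bag i
    ... | yes v∈bag = no λ (_ , _ , v∉bag , _) → v∉bag v∈bag
    ... | no v∉bag with side-exists v∉bag
    ...   | j , s with proj₂ Q j
    ...     | yes q = yes (j , q , s)
    ...     | no ¬q = no λ (_ , q , s′) → ¬q (subst (proj₁ Q) (side-unique s′ s) q)

    indicator : Selection → Fin nodes → KSubset n k → ℕ
    indicator Q i A = 𝟙 (inSides? Q i (inj₁ A))

    -- A shares a bag with B, and B shares one with A′. Neither step changes the side, as B and A′
    -- avoid the bag of i.
    inSides-transfer : ∀ {Q i A A′ B} → InSides Q i (inj₁ A) → proj₁ A ⊆ proj₁ B → proj₁ A′ ⊆ proj₁ B →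
      inj₁ A′ ∉ bag i → inj₂ B ∉ bag i → InSides Q i (inj₁ A′)
    inSides-transfer {A = A} {A′} {B} (j , q , s) A⊆B A′⊆B A′∉ B∉
      with edge-covered {inj₁ A} {inj₂ B} A⊆B | edge-covered {inj₁ A′} {inj₂ B} A′⊆B
    ... | h , A∈ , B∈ | h′ , A′∈ , B∈′ =
      j , q , side-transfer (side-transfer s B∉ A∈ B∈) A′∉ B∈′ A′∈

    indicator-transfer : ∀ Q i A A′ B →
      proj₁ A ⋖ proj₁ B → proj₁ A′ ⋖ proj₁ B →
      indicator Q i A ≤ indicator Q i A′ + occurrences (bag i) (inj₁ A′) + occurrences (bag i) (upper B)
    indicator-transfer Q i A A′ B A⋖B A′⋖B = 𝟙-≤ (inSides? Q i (inj₁ A)) (bound (inj₁ A′ ∈? bag i) (upper B ∈? bag i))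
      where
      bound : Dec (inj₁ A′ ∈ bag i) → Dec (upper B ∈ bag i) → InSides Q i (inj₁ A) →
        1 ≤ indicator Q i A′ + occurrences (bag i) (inj₁ A′) + occurrences (bag i) (upper B)
      bound (yes A′∈) _        A-in = ≤-trans (∈⇒occurs A′∈)
                                 (≤-trans (m≤n+m _ (indicator Q i A′)) (m≤m+n _ _))
      bound (no _)    (yes B∈) A-in = ≤-trans (∈⇒occurs B∈) (m≤n+m _ _)
      bound (no A′∉)  (no B∉)  A-in = ≤-trans
        (𝟙-true (inSides? Q i (inj₁ A′)) (inSides-transfer {Q} {A = A} {A′} {proj₁ B , trans (proj₂ B) (sym n∸k≡k+1)} A-in (⋖⇒⊆ A⋖B) (⋖⇒⊆ A′⋖B) A′∉ B∉))
        (≤-trans (m≤m+n _ _) (m≤m+n _ _))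

    weight : Selection → Fin nodes → ℕ
    weight Q i = levelSum n k (indicator Q i)

    -- The bag of i is the blocking family, and two disjoint groups of branches at i give the
    -- separated families.
    weight-expansion : ∀ Q Q′ → (∀ j → proj₁ Q j → ¬ proj₁ Q′ j) → ∀ i →
      weight Q i *ℕ weight Q′ i ≤ (weight Q i + weight Q′ i) *ℕ M
    weight-expansion Q Q′ disj i = ≤-trans
      (expansion n k {s = indicator Q i} {t = indicator Q′ i} {x = occurrences (bag i) ∘ inj₁} {y = occurrences (bag i) ∘ upper}
      (record
      { disjoint   = λ A → disjoint-indicators A
      ; transfer-s = indicator-transfer Q i
      ; transfer-t = indicator-transfer Q′ i
      }))
      (*-monoʳ-≤ (weight Q i + weight Q′ i)
        (*-monoʳ-≤ n (≤-trans (Σ-occurrences≤length (bag i)) (bag≤m i))))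
      where
      disjoint-indicators : ∀ A → indicator Q i A *ℕ indicator Q′ i A ≡ 0
      disjoint-indicators A = 𝟙-*-disjoint (inSides? Q i (inj₁ A)) (inSides? Q′ i (inj₁ A))
        λ ((j , q , s) , (j′ , q′ , s′)) → disj j q (subst (proj₁ Q′) (side-unique s′ s) q′)

    light : ∀ c i → weight (low c) i *ℕ weight (high c) i ≤ (weight (low c) i + weight (high c) i) *ℕ M
    light c = weight-expansion (low c) (high c) (λ j → <⇒≱)

    -- A k-set outside the bag of i lies on some side j, and j is below, equal to or above c; the
    -- sets in the bag account for m.
    N≤low+exact+high : ∀ i c → (c<nodes : c <ℕ nodes) →
      N ≤ weight (low c) i + weight (only (fromℕ< c<nodes)) i + weight (high (suc c)) i + m
    N≤low+exact+high i c c<nodes = begin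
      N                                     ≡⟨ sym (levelSum-1 n k) ⟩
      levelSum n k (λ _ → 1)                ≤⟨ levelSum-mono n k pointwise ⟩
      levelSum n k (λ A → f A + g A + h A + x A)
        ≡⟨ trans (levelSum-+ n k (λ A → f A + g A + h A) x)
             (cong (_+ levelSum n k x) (trans (levelSum-+ n k (λ A → f A + g A) h)
               (cong (_+ levelSum n k h) (levelSum-+ n k f g)))) ⟩
      weight (low c) i + weight (only (fromℕ< c<nodes)) i + weight (high (suc c)) i + levelSum n k x
        ≤⟨ +-monoʳ-≤ (weight (low c) i + weight (only (fromℕ< c<nodes)) i + weight (high (suc c)) i)
             (≤-trans (m≤m+n (levelSum n k x) _) (≤-trans (Σ-occurrences≤length (bag i)) (bag≤m i))) ⟩
      weight (low c) i + weight (only (fromℕ< c<nodes)) i + weight (high (suc c)) i + m ∎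
      where
      open ≤-Reasoning
      f g h x : KSubset n k → ℕ
      f = indicator (low c) i
      g = indicator (only (fromℕ< c<nodes)) i
      h = indicator (high (suc c)) i
      x = occurrences (bag i) ∘ inj₁
      located : ∀ A → (∃ λ j → Side i j (inj₁ A)) → 1 ≤ f A + g A + h A + x A
      located A (j , s) with <-cmp (toℕ j) c
      ... | tri< j<c _ _ = ≤-trans (𝟙-true (inSides? (low c) i (inj₁ A)) (j , j<c , s))
        (≤-trans (≤-trans (m≤m+n (f A) (g A)) (m≤m+n _ (h A))) (m≤m+n _ (x A)))
      ... | tri≈ _ j≡c _ = ≤-trans
        (𝟙-true (inSides? (only (fromℕ< c<nodes)) i (inj₁ A))
          (j , toℕ-injective (trans (toℕ-fromℕ< c<nodes) (sym j≡c)) , s))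
        (≤-trans (≤-trans (m≤n+m (g A) (f A)) (m≤m+n _ (h A))) (m≤m+n _ (x A)))
      ... | tri> _ _ c<j = ≤-trans (𝟙-true (inSides? (high (suc c)) i (inj₁ A)) (j , c<j , s))
        (≤-trans (m≤n+m (h A) (f A + g A)) (m≤m+n _ (x A)))
      pointwise′ : ∀ A → Dec (inj₁ A ∈ bag i) → 1 ≤ f A + g A + h A + x A
      pointwise′ A (yes A∈) = ≤-trans (∈⇒occurs A∈) (m≤n+m _ (f A + g A + h A))
      pointwise′ A (no A∉)  = located A (side-exists A∉)
      pointwise : ∀ A → 1 ≤ f A + g A + h A + x A
      pointwise A = pointwise′ A (inj₁ A ∈? bag i)

    sideWeight : Fin nodes → Fin nodes → ℕ
    sideWeight i j = weight (only j) i

    -- As c grows, branches pass from the high group to the low one. Where the balance turns, the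
    -- group below c and the group above c weigh at most 2M each by `smaller-side`, and the bag
    -- holds at most m ≤ M sets. The branch numbered c is left with at least N - 5M, more than N/2.
    heavy-side : .{{NonZero n}} → ∀ i → 10 *ℕ M <ℕ N → ∃ λ j → N <ℕ 2 *ℕ sideWeight i j
    heavy-side i 10M<N = from-crossing
      (crossing {P = λ c → weight (low c) i ≤ weight (high c) i}
                {Q = λ c → weight (high c) i ≤ weight (low c) i}
                (λ c → ≤-total (weight (low c) i) (weight (high c) i)) (nodes ∸ 1)
        -- The low group is empty at threshold 0, the high group at threshold `nodes`, written as
        -- the successor of `nodes ∸ 1`.
        (≤-trans (levelSum-zero n k λ A → 𝟙-false (inSides? (low 0) i (inj₁ A)) λ ()) z≤n)
        (≤-trans (levelSum-zero n k λ A → 𝟙-false (inSides? (high (suc (nodes ∸ 1))) i (inj₁ A))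
           λ (j , high , _) → <⇒≱ (toℕ<n j) (≤-trans (≤-reflexive (sym (suc-pred nodes {{Fin⇒NonZero i}}))) high)) z≤n))
      where
      Fin⇒NonZero : ∀ {o} → Fin o → NonZero o
      Fin⇒NonZero zero    = _
      Fin⇒NonZero (suc _) = _
      from-crossing : (∃ λ c → c <ℕ suc (nodes ∸ 1) × weight (low c) i ≤ weight (high c) i ×
                         weight (high (suc c)) i ≤ weight (low (suc c)) i) →
        ∃ λ j → N <ℕ 2 *ℕ sideWeight i j
      from-crossing (c , c<nodes′ , low≤high , high≤low) =
        fromℕ< c<nodes , +-cancelʳ-< N _ _ (begin-strict
          N + N                          ≤⟨ +-mono-≤ N≤ N≤ ⟩
          (5 *ℕ M + e) + (5 *ℕ M + e)    ≡⟨ regroup M e ⟩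
          2 *ℕ e + 10 *ℕ M               <⟨ +-monoʳ-< (2 *ℕ e) 10M<N ⟩
          2 *ℕ e + N                     ∎)
        where
        open ≤-Reasoning
        c<nodes : c <ℕ nodes
        c<nodes = subst (c <ℕ_) (suc-pred nodes {{Fin⇒NonZero i}}) c<nodes′
        e : ℕ
        e = sideWeight i (fromℕ< c<nodes)
        regroup : ∀ M e → (5 *ℕ M + e) + (5 *ℕ M + e) ≡ 2 *ℕ e + 10 *ℕ M
        regroup = solve-∀
        collect : ∀ M e → 2 *ℕ M + e + 2 *ℕ M + M ≡ 5 *ℕ M + e
        collect = solve-∀
        N≤ : N ≤ 5 *ℕ M + e
        N≤ = ≤-trans (N≤low+exact+high i c c<nodes) (≤-trans
          (+-mono-≤ (+-mono-≤ (+-monoˡ-≤ e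
              (smaller-side (weight (low c) i) _ M (light c i) low≤high))
              (smaller-side (weight (high (suc c)) i) (weight (low (suc c)) i) M
                (subst₂ _≤_ (*-comm (weight (low (suc c)) i) _)
                  (cong (_*ℕ M) (+-comm (weight (low (suc c)) i) _)) (light (suc c) i)) high≤low))
            (m≤n*m m n))
          (≤-reflexive (collect M e)))

    -- A node that is not adjacent to i names no branch at i, so its side has weight 0.
    heavy⇒~ᵀ : ∀ {i j} → N <ℕ 2 *ℕ sideWeight i j → i ~ᵀ j
    heavy⇒~ᵀ {i} {j} heavy with i ~ᵀ? j
    ... | yes i~j = i~j
    ... | no i≁j  = contradiction (≤-trans heavy (*-monoʳ-≤ 2
      (levelSum-zero n k λ A → 𝟙-false (inSides? (only j) i (inj₁ A)) λ { (_ , refl , s) → i≁j (side-~ᵀ s) })))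
      λ ()

    -- A set on both sides would have a bag in two opposite branches, so the two weights add up to
    -- at most N.
    not-both-heavy : ¬ (∃ λ i → ∃ λ j → N <ℕ 2 *ℕ sideWeight i j × N <ℕ 2 *ℕ sideWeight j i)
    not-both-heavy (i , j , heavy , heavy′) = <-irrefl refl (begin-strict
      N + N                                         <⟨ +-mono-< heavy heavy′ ⟩
      2 *ℕ sideWeight i j + 2 *ℕ sideWeight j i     ≡⟨ sym (*-distribˡ-+ 2 (sideWeight i j) _) ⟩
      2 *ℕ (sideWeight i j + sideWeight j i)        ≤⟨ *-monoʳ-≤ 2 disjoint-sum ⟩
      2 *ℕ N                                        ≡⟨ cong (λ r → N + r) (+-identityʳ N) ⟩
      N + N                                         ∎)
      where
      open ≤-Reasoning
      disjoint-sum : sideWeight i j + sideWeight j i ≤ N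
      disjoint-sum = ≤-trans (≤-reflexive (sym (levelSum-+ n k (indicator (only j) i) (indicator (only i) j))))
        (≤-trans (levelSum-mono n k λ A →
            𝟙-disjoint (inSides? (only j) i (inj₁ A)) (inSides? (only i) j (inj₁ A))
              λ { ((_ , refl , s) , (_ , refl , s′)) →
                let _ , A∈ = vertex-covered (inj₁ A) in opposite-sides s s′ A∈ A∈ })
          (≤-reflexive (levelSum-1 n k)))

    nCk≤10nm : .{{NonZero n}} → n C k ≤ 10 *ℕ (n *ℕ m)
    nCk≤10nm = ≮⇒≥ λ 10M<N → not-both-heavy
      (Tree.mutual-choice tree isTree (λ i → heavy-side i 10M<N) heavy⇒~ᵀ (SimpleGraph.IsTree.root isTree))

-- Cliques of the Johnson graph

-- The separate clause for k = 0 is there because the tail of B is then empty and has nothing below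
-- it.
below : ∀ {n k} → KSubset n (suc k) → List (KSubset n k)
below {suc n} {k}     (outside ∷ B , p) = map outside∷ (below (B , p))
below {suc n} {zero}  (inside ∷ B , p)  = outside∷ (B , suc-injective p) ∷ []
below {suc n} {suc k} (inside ∷ B , p)  =
  outside∷ (B , suc-injective p) ∷ map inside∷ (below (B , suc-injective p))

length-below : ∀ {n k} (B : KSubset n (suc k)) → length (below B) ≡ suc k
length-below {suc n} {k}     (outside ∷ B , p) =
  trans (length-map outside∷ (below (B , p))) (length-below (B , p))
length-below {suc n} {zero}  (inside ∷ B , p)  = refl
length-below {suc n} {suc k} (inside ∷ B , p)  =
  cong suc (trans (length-map inside∷ (below (B , suc-injective p))) (length-below (B , suc-injective p)))

⊆∧∣≡∣⇒≡ : ∀ {n} {A B : Subset n} → A ⊆ B → ∣ A ∣ ≡ ∣ B ∣ → A ≡ B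
⊆∧∣≡∣⇒≡ {A = []}          {[]}          _   _ = refl
⊆∧∣≡∣⇒≡ {A = outside ∷ A} {outside ∷ B} A⊆B e = cong (outside ∷_) (⊆∧∣≡∣⇒≡ (drop-∷-⊆ A⊆B) e)
⊆∧∣≡∣⇒≡ {A = outside ∷ A} {inside ∷ B}  A⊆B e =
  contradiction (subst (_≤ ∣ B ∣) e (p⊆q⇒∣p∣≤∣q∣ (drop-∷-⊆ A⊆B))) (<⇒≱ ≤-refl)
⊆∧∣≡∣⇒≡ {A = inside ∷ A}  {outside ∷ B} A⊆B e = case A⊆B hereᵛ of λ ()
⊆∧∣≡∣⇒≡ {A = inside ∷ A}  {inside ∷ B}  A⊆B e =
  cong (inside ∷_) (⊆∧∣≡∣⇒≡ (drop-∷-⊆ A⊆B) (suc-injective e))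

below-complete : ∀ {n k} (A : KSubset n k) (B : KSubset n (suc k)) → proj₁ A ⊆ proj₁ B → A ∈ below B
below-complete {suc n} (outside ∷ A , p) (outside ∷ B , q) A⊆B =
  ∈-map⁺ outside∷ (below-complete (A , p) (B , q) (drop-∷-⊆ A⊆B))
below-complete {suc n} (inside ∷ A , p) (outside ∷ B , q) A⊆B = case A⊆B hereᵛ of λ ()
below-complete {suc n} {zero} (outside ∷ A , p) (inside ∷ B , q) A⊆B =
  here (KSubset-≡ (cong (outside ∷_) (⊆∧∣≡∣⇒≡ (drop-∷-⊆ A⊆B) (trans p (sym (suc-injective q))))))
below-complete {suc n} {suc k} (outside ∷ A , p) (inside ∷ B , q) A⊆B =
  here (KSubset-≡ (cong (outside ∷_) (⊆∧∣≡∣⇒≡ (drop-∷-⊆ A⊆B) (trans p (sym (suc-injective q))))))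
below-complete {suc n} {suc k} (inside ∷ A , p) (inside ∷ B , q) A⊆B =
  -- The two sets differ only in the proof of their size.
  there (subst (_∈ map inside∷ (below (B , suc-injective q))) (KSubset-≡ refl)
    (∈-map⁺ inside∷ (below-complete (A , suc-injective p) (B , suc-injective q) (drop-∷-⊆ A⊆B))))

below-∩ : ∀ {n k} (B : KSubset n (suc k)) → All (λ A → ∣ proj₁ B ∩ proj₁ A ∣ ≡ k) (below B)
below-∩ {suc n} {k}     (outside ∷ B , p) = Allₚ.map⁺ (below-∩ (B , p))
below-∩ {suc n} {zero}  (inside ∷ B , p)  = trans (cong ∣_∣ (∩-idem B)) (suc-injective p) ∷ []
below-∩ {suc n} {suc k} (inside ∷ B , p)  = trans (cong ∣_∣ (∩-idem B)) (suc-injective p) ∷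
  Allₚ.map⁺ (All.map (cong suc) (below-∩ (B , suc-injective p)))

-- The first set `outside ∷ B` meets a later one `inside ∷ A` in B ∩ A, counted by `below-∩`.
below-clique : ∀ {n k} (B : KSubset n (suc k)) → AllPairs (SimpleGraph._~_ (Johnson n k)) (below B)
below-clique {suc n} {k}     (outside ∷ B , p) = AllPairsₚ.map⁺ (below-clique (B , p))
below-clique {suc n} {zero}  (inside ∷ B , p)  = [] ∷ []
below-clique {suc n} {suc k} (inside ∷ B , p)  =
  Allₚ.map⁺ (All.map (cong suc) (below-∩ (B , suc-injective p))) ∷
  AllPairsₚ.map⁺ (AllPairs.map (cong suc) (below-clique (B , suc-injective p)))

-- The other kind of clique in a Johnson graph. In J(2k+1,k) the k-sets above a (k-1)-set number k +
-- 2, the size of the bags added when passing to BK.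
above : ∀ {n k} → KSubset n k → List (KSubset n (suc k))
above {zero}          _                 = []
above {suc n}         (outside ∷ A , p) = inside∷ (A , p) ∷ map outside∷ (above (A , p))
above {suc n} {suc k} (inside ∷ A , p)  = map inside∷ (above (A , suc-injective p))

length-above : ∀ {n k} (A : KSubset n k) → k + length (above A) ≡ n
length-above {zero}  ([] , refl)     = refl
length-above {suc n} {k} (outside ∷ A , p) = trans (+-suc k _) (cong suc
  (trans (cong (λ l → k + l) (length-map outside∷ (above (A , p)))) (length-above (A , p))))
length-above {suc n} {suc k} (inside ∷ A , p)  = cong suc
  (trans (cong (λ l → k + l) (length-map inside∷ (above (A , suc-injective p)))) (length-above (A , suc-injective p)))

above-∩ : ∀ {n k} (A : KSubset n k) → All (λ B → ∣ proj₁ A ∩ proj₁ B ∣ ≡ k) (above A)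
above-∩ {zero}          _                 = []
above-∩ {suc n}         (outside ∷ A , p) =
  trans (cong ∣_∣ (∩-idem A)) p ∷ Allₚ.map⁺ (above-∩ (A , p))
above-∩ {suc n} {suc k} (inside ∷ A , p)  =
  Allₚ.map⁺ (All.map (cong suc) (above-∩ (A , suc-injective p)))

above-clique : ∀ {n k} (A : KSubset n k) → AllPairs (SimpleGraph._~_ (Johnson n (suc k))) (above A)
above-clique {zero}          _                 = []
above-clique {suc n}         (outside ∷ A , p) =
  Allₚ.map⁺ (All.map (cong suc) (above-∩ (A , p))) ∷ AllPairsₚ.map⁺ (above-clique (A , p))
above-clique {suc n} {suc k} (inside ∷ A , p)  =
  AllPairsₚ.map⁺ (AllPairs.map (cong suc) (above-clique (A , suc-injective p)))

cover-exists : ∀ {n k} → k <ℕ n → ∃ λ (A : KSubset n k) → ∃ λ (B : KSubset n (suc k)) → proj₁ A ⋖ proj₁ B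
cover-exists {suc n} {zero}  (s≤s z≤n) = outside∷ (⊥ , ∣⊥∣≡0 n) , inside∷ (⊥ , ∣⊥∣≡0 n) , add
cover-exists {suc n} {suc k} (s≤s k<n) with cover-exists k<n
... | A , B , A⋖B = inside∷ A , inside∷ B , inside ∷ A⋖B

module Cliques {n k : ℕ} (D : TreeDecomposition (Johnson n k)) where
  open SimpleGraph (Johnson n k) using (_~_)
  open TreeDecomposition D

  -- Equal members are served by `vertex-covered`, as no vertex is adjacent to itself.
  clique-shares : ∀ {K} → AllPairs _~_ K → ∀ {u v} → u ∈ K → v ∈ K → ∃ λ h → u ∈ bag h × v ∈ bag h
  clique-shares (_ ∷ _) {u} (here refl) (here refl) with vertex-covered u
  ... | h , u∈ = h , u∈ , u∈
  clique-shares (u~ ∷ _) {u} {v} (here refl) (there v∈K) = edge-covered {u} {v} (All.lookup u~ v∈K)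
  clique-shares (v~ ∷ _) {u} {v} (there u∈K) (here refl) with edge-covered {v} {u} (All.lookup v~ u∈K)
  ... | h , v∈ , u∈ = h , u∈ , v∈
  clique-shares (_ ∷ K) (there u∈K) (there v∈K) = clique-shares K u∈K v∈K

  johnson-clique⊆bag : ∀ {K} → AllPairs _~_ K → ∃ λ i → All (_∈ bag i) K
  johnson-clique⊆bag {K} clique = Decomposition.clique⊆bag _≟ˢ_ D K (clique-shares clique)

clique-unique : ∀ {n k} {K : List (KSubset n k)} → AllPairs (SimpleGraph._~_ (Johnson n k)) K → Unique K
clique-unique {n} {k} = AllPairs.map λ u~v u≡v → SimpleGraph.~-irrefl (Johnson n k) u≡v u~v

length-kSubsets : ∀ n k → length (kSubsets n k) ≡ n C k
length-kSubsets zero    zero    = refl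
length-kSubsets zero    (suc k) = refl
length-kSubsets (suc n) zero    = trans (length-map outside∷ (kSubsets n zero)) (length-kSubsets n zero)
length-kSubsets (suc n) (suc k) = begin
  length (map outside∷ (kSubsets n (suc k)) ++ map inside∷ (kSubsets n k))
    ≡⟨ length-++ (map outside∷ (kSubsets n (suc k))) ⟩
  length (map outside∷ (kSubsets n (suc k))) + length (map inside∷ (kSubsets n k))
    ≡⟨ cong₂ _+_ (length-map outside∷ (kSubsets n (suc k))) (length-map inside∷ (kSubsets n k)) ⟩
  length (kSubsets n (suc k)) + length (kSubsets n k)
    ≡⟨ cong₂ _+_ (length-kSubsets n (suc k)) (length-kSubsets n k) ⟩
  n C suc k + n C k   ≡⟨ +-comm (n C suc k) (n C k) ⟩
  n C k + n C suc k   ≡⟨ nCk+nC[k+1]≡[n+1]C[k+1] n k ⟩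
  suc n C suc k       ∎
  where open ≡-Reasoning

-- From decompositions of J to decompositions of BK

-- The new leaf is `zero`, attached at h; old nodes are shifted by `suc`.
module Leaf {m : ℕ} (T : SimpleGraph (Fin m)) (h : Fin m) where
  open SimpleGraph T

  LeafAdj : Rel (Fin (suc m)) 0ℓ
  LeafAdj zero    zero    = Empty
  LeafAdj zero    (suc j) = j ≡ h
  LeafAdj (suc i) zero    = i ≡ h
  LeafAdj (suc i) (suc j) = i ~ j

  leafAdj? : ∀ i j → Dec (LeafAdj i j)
  leafAdj? zero    zero    = no λ ()
  leafAdj? zero    (suc j) = j ≟ᶠ h
  leafAdj? (suc i) zero    = i ≟ᶠ h
  leafAdj? (suc i) (suc j) = i ~? j

  leafAdj-sym : ∀ {i j} → LeafAdj i j → LeafAdj j i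
  leafAdj-sym {zero}  {suc j} j≡h = j≡h
  leafAdj-sym {suc i} {zero}  i≡h = i≡h
  leafAdj-sym {suc i} {suc j} i~j = ~-sym i~j

  leafAdj-irrefl : ∀ {i j} → i ≡ j → ¬ LeafAdj i j
  leafAdj-irrefl {zero}  refl ()
  leafAdj-irrefl {suc i} refl i~i = ~-irrefl refl i~i

  attachLeaf : SimpleGraph (Fin (suc m))
  attachLeaf = record
    { _~_ = LeafAdj ; _~?_ = leafAdj? ; ~-sym = λ {i} {j} → leafAdj-sym {i} {j} ; ~-irrefl = leafAdj-irrefl }

  leaf-neighbour : ∀ {a b} → LeafAdj a zero → LeafAdj zero b → a ≡ b
  leaf-neighbour {suc a} {suc b} a≡h b≡h = cong suc (trans a≡h (sym b≡h))

  linked-last : ∀ {a x} l → Linked LeafAdj ((a ∷ l) ∷ʳ x) → ∃ λ w → w ∈ a ∷ l × LeafAdj w x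
  linked-last []      (r ∷ [-]) = _ , here refl , r
  linked-last (b ∷ l) (_ ∷ rs) with linked-last l rs
  ... | w , w∈ , r = w , there w∈ , r

  -- Predecessor and successor of the leaf on the cycle would both be its only neighbour. They
  -- differ by `Unique`, or, if the leaf comes last, because the successor x is off the list.
  interior≢leaf : ∀ {a x} l → Linked LeafAdj ((a ∷ l) ∷ʳ x) → Unique (a ∷ l) → All (x ≢_) (a ∷ l) →
    zero ∉ l
  interior≢leaf (zero ∷ [])    (r ∷ r′ ∷ _)  _                    (x≢a ∷ _) (here refl) =
    x≢a (sym (leaf-neighbour r r′))
  interior≢leaf (zero ∷ b ∷ l) (r ∷ r′ ∷ _) ((_ ∷ a≢b ∷ _) ∷ _) _         (here refl) =
    a≢b (leaf-neighbour r r′)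
  interior≢leaf (b ∷ l)        (_ ∷ rs)      (_ ∷ u)              (_ ∷ x∉)  (there 0∈l) =
    interior≢leaf l rs u x∉ 0∈l

  unmap-suc : (l : List (Fin (suc m))) → zero ∉ l → ∃ λ l′ → l ≡ map suc l′
  unmap-suc []          _   = [] , refl
  unmap-suc (zero ∷ l)  0∉l = contradiction (here refl) 0∉l
  unmap-suc (suc i ∷ l) 0∉l with unmap-suc l (0∉l ∘ there)
  ... | l′ , refl = i ∷ l′ , refl

  -- The leaf can be neither first nor second on a cycle, nor later by `interior≢leaf`. A cycle
  -- without it is the image under `suc` of a cycle of T.
  attachLeaf-acyclic : ¬ Cycle → ¬ SimpleGraph.Cycle attachLeaf
  attachLeaf-acyclic acyclic (zero , y , z , zs , (_ ∷ y∉ ∷ _) , r ∷ _ ∷ rs) with linked-last zs rs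
  ... | w , w∈ , r′ = All.lookup y∉ w∈ (sym (leaf-neighbour r′ r))
  attachLeaf-acyclic acyclic (suc x , zero , z , zs , ((_ ∷ x≢z ∷ _) ∷ _) , r ∷ r′ ∷ _) =
    x≢z (leaf-neighbour r r′)
  attachLeaf-acyclic acyclic (suc x , suc y , z , zs , u@(x∉ ∷ u′) , rs@(_ ∷ rs′))
    with unmap-suc (z ∷ zs) (interior≢leaf (z ∷ zs) rs′ u′ x∉)
  ... | z′ ∷ zs′ , refl = acyclic (x , y , z′ , zs′ ,
    AllPairs.map (_∘ cong suc) (AllPairsₚ.map⁻ {xs = x ∷ y ∷ z′ ∷ zs′} u) ,
    Linkedₚ.map⁻ {f = suc} {xs = (x ∷ y ∷ z′ ∷ zs′) ∷ʳ x}
      (subst (Linked LeafAdj) (sym (map-++ suc (x ∷ y ∷ z′ ∷ zs′) (x ∷ []))) rs))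

  attachLeaf-connected : Connected → SimpleGraph.Connected attachLeaf
  attachLeaf-connected conn zero    zero    = ε
  attachLeaf-connected conn zero    (suc j) = refl ◅ gmap suc (λ r → r) (conn h j)
  attachLeaf-connected conn (suc i) zero    = gmap suc (λ r → r) (conn i h) ◅◅ (refl ◅ ε)
  attachLeaf-connected conn (suc i) (suc j) = gmap suc (λ r → r) (conn i j)

  attachLeaf-isTree : IsTree → SimpleGraph.IsTree attachLeaf
  attachLeaf-isTree isTree = record
    { root      = zero
    ; connected = attachLeaf-connected (SimpleGraph.IsTree.connected isTree)
    ; acyclic   = attachLeaf-acyclic (SimpleGraph.IsTree.acyclic isTree)
    }

module Transfer {n k : ℕ} (n∸k≡k+1 : n ∸ k ≡ suc k) (t : ℕ) (k+1≤t : suc k ≤ t) where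

  W : Set
  W = KSubset n (n ∸ k)

  lowerSets : W → List (KSubset n k)
  lowerSets (B , p) = below (B , trans p n∸k≡k+1)

  -- A decomposition of the subgraph of BK(n,k) in which only the (n−k)-sets in
  -- ws are present.
  record Partial (ws : List W) : Set₁ where
    field
      nodes      : ℕ
      tree       : SimpleGraph (Fin nodes)
      isTree     : SimpleGraph.IsTree tree
      bag        : Fin nodes → List (BKVertex n k)
      bag-unique : ∀ i → Unique (bag i)
      bag-length : ∀ i → length (bag i) ≤ suc t
    open SimpleGraph tree using () renaming (_~_ to _~ᵀ_)
    field
      set-covered    : ∀ A → ∃ λ i → inj₁ A ∈ bag i
      clique-covered : ∀ B → ∃ λ i → ∀ {A} → A ∈ lowerSets B → inj₁ A ∈ bag i
      star-covered   : ∀ {B} → B ∈ ws →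
        ∃ λ i → inj₂ B ∈ bag i × (∀ {A} → A ∈ lowerSets B → inj₁ A ∈ bag i)
      present        : ∀ {B i} → inj₂ B ∈ bag i → B ∈ ws
      bags-connected : ∀ v {i j} → v ∈ bag i → v ∈ bag j →
        Star (λ a b → a ~ᵀ b × v ∈ bag a × v ∈ bag b) i j

  initial : (D : TreeDecomposition (Johnson n k)) →
    (∀ i → length (TreeDecomposition.bag D i) ≤ suc t) → Partial []
  initial D bag≤ = record
    { nodes          = nodes
    ; tree           = tree
    ; isTree         = isTree
    ; bag            = λ i → map inj₁ (bag i)
    ; bag-unique     = λ i → Uniqueₚ.map⁺ inj₁-injective (bag-unique i)
    ; bag-length     = λ i → ≤-trans (≤-reflexive (length-map inj₁ (bag i))) (bag≤ i)
    ; set-covered    = λ A → let i , A∈ = vertex-covered A in i , ∈-map⁺ inj₁ A∈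
    ; clique-covered = λ (B , p) →
        let i , all = Cliques.johnson-clique⊆bag D (below-clique (B , trans p n∸k≡k+1))
        in i , λ A∈ → ∈-map⁺ inj₁ (All.lookup all A∈)
    ; star-covered   = λ ()
    ; present        = λ B∈ → case ∈-map⁻ inj₁ B∈ of λ ()
    ; bags-connected = conn
    }
    where
    open TreeDecomposition D
    conn : ∀ v {i j} → v ∈ map inj₁ (bag i) → v ∈ map inj₁ (bag j) → Star _ i j
    conn v v∈i v∈j with ∈-map⁻ inj₁ v∈i | ∈-map⁻ inj₁ v∈j
    ... | A , A∈i , refl | _ , A∈j , refl =
      Star-map (λ (r , A∈a , A∈b) → r , ∈-map⁺ inj₁ A∈a , ∈-map⁺ inj₁ A∈b) (bags-connected A A∈i A∈j)

  -- The set B is in no old bag, by `present`, and the k-sets below B all lie in the bag of h. So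
  -- for every vertex the nodes containing it stay connected when the leaf is added.
  extend : ∀ {ws} B → B ∉ ws → Partial ws → Partial (B ∷ ws)
  extend {ws} B B∉ws P = record
    { nodes          = suc nodes
    ; tree           = attachLeaf
    ; isTree         = attachLeaf-isTree isTree
    ; bag            = bag′
    ; bag-unique     = unique
    ; bag-length     = len
    ; set-covered    = λ A → let i , A∈ = set-covered A in suc i , A∈
    ; clique-covered = λ B′ → let i , A∈ = clique-covered B′ in suc i , A∈
    ; star-covered   = star
    ; present        = λ {_} {i} → present′ {i = i}
    ; bags-connected = conn
    }
    where
    open Partial P
    h : Fin nodes
    h = proj₁ (clique-covered B)
    open Leaf tree h
    bag′ : Fin (suc nodes) → List (BKVertex n k)
    bag′ zero    = inj₂ B ∷ map inj₁ (lowerSets B)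
    bag′ (suc i) = bag i
    unique : ∀ i → Unique (bag′ i)
    unique zero    = Allₚ.map⁺ (All.universal (λ _ ()) _) ∷
      Uniqueₚ.map⁺ inj₁-injective (clique-unique (below-clique (proj₁ B , trans (proj₂ B) n∸k≡k+1)))
    unique (suc i) = bag-unique i
    len : ∀ i → length (bag′ i) ≤ suc t
    len zero    = s≤s (≤-trans (≤-reflexive (trans (length-map inj₁ (lowerSets B))
      (length-below (proj₁ B , trans (proj₂ B) n∸k≡k+1)))) k+1≤t)
    len (suc i) = bag-length i
    star : ∀ {B′} → B′ ∈ B ∷ ws →
      ∃ λ i → inj₂ B′ ∈ bag′ i × (∀ {A} → A ∈ lowerSets B′ → inj₁ A ∈ bag′ i)
    star (here refl) = zero , here refl , λ A∈ → there (∈-map⁺ inj₁ A∈)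
    star (there B′∈) = let i , rest = star-covered B′∈ in suc i , rest
    present′ : ∀ {B′ i} → inj₂ B′ ∈ bag′ i → B′ ∈ B ∷ ws
    present′ {i = zero}  (here refl) = here refl
    present′ {i = zero}  (there B∈)  = case ∈-map⁻ inj₁ B∈ of λ ()
    present′ {i = suc i} B∈          = there (present B∈)
    leaf⇒base : ∀ {v j} → v ∈ bag′ zero → v ∈ bag j → v ∈ bag h
    leaf⇒base (here refl) v∈j = contradiction (present v∈j) B∉ws
    leaf⇒base (there v∈)  v∈j with ∈-map⁻ inj₁ v∈
    ... | A , A∈ , refl = proj₂ (clique-covered B) A∈
    conn : ∀ v {i j} → v ∈ bag′ i → v ∈ bag′ j →
      Star (λ a b → LeafAdj a b × v ∈ bag′ a × v ∈ bag′ b) i j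
    conn v {zero}  {zero}  _   _   = ε
    conn v {zero}  {suc j} v∈0 v∈j =
      (refl , v∈0 , leaf⇒base v∈0 v∈j) ◅ gmap suc (λ r → r) (bags-connected v (leaf⇒base v∈0 v∈j) v∈j)
    conn v {suc i} {zero}  v∈i v∈0 =
      gmap suc (λ r → r) (bags-connected v v∈i (leaf⇒base v∈0 v∈i)) ◅◅
      ((refl , leaf⇒base v∈0 v∈i , v∈0) ◅ ε)
    conn v {suc i} {suc j} v∈i v∈j = gmap suc (λ r → r) (bags-connected v v∈i v∈j)

  extendAll : Partial [] → (ws : List W) → ∃ λ ws′ → (∀ {B} → B ∈ ws → B ∈ ws′) × Partial ws′
  extendAll P [] = [] , (λ ()) , P
  extendAll P (B ∷ ws) with extendAll P ws
  ... | ws′ , ws⊆ws′ , P′ with DecMembership._∈?_ _≟ˢ_ B ws′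
  ...   | yes B∈ws′ = ws′ , (λ { (here refl) → B∈ws′ ; (there B∈) → ws⊆ws′ B∈ }) , P′
  ...   | no B∉ws′  =
    B ∷ ws′ , (λ { (here refl) → here refl ; (there B∈) → there (ws⊆ws′ B∈) }) , extend B B∉ws′ P′

  complete : ∀ {ws} → (∀ B → B ∈ ws) → Partial ws →
    Σ (TreeDecomposition (BipartiteKneser n k)) λ D → ∀ i → length (TreeDecomposition.bag D i) ≤ suc t
  complete all P = record
    { nodes          = nodes
    ; tree           = tree
    ; isTree         = isTree
    ; bag            = bag
    ; bag-unique     = bag-unique
    ; vertex-covered = vertex
    ; edge-covered   = λ {u} {v} → edge u v
    ; bags-connected = bags-connected
    } , bag-length
    where
    open Partial P
    vertex : ∀ v → ∃ λ i → v ∈ bag i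
    vertex (inj₁ A) = set-covered A
    vertex (inj₂ B) = let i , B∈ , _ = star-covered (all B) in i , B∈
    edge : ∀ u v → SimpleGraph._~_ (BipartiteKneser n k) u v → ∃ λ i → u ∈ bag i × v ∈ bag i
    edge (inj₁ A) (inj₂ B) A⊆B = let i , B∈ , A∈ = star-covered (all B) in
      i , A∈ (below-complete A (proj₁ B , trans (proj₂ B) n∸k≡k+1) A⊆B) , B∈
    edge (inj₂ B) (inj₁ A) A⊆B = let i , B∈ , A∈ = star-covered (all B) in
      i , B∈ , A∈ (below-complete A (proj₁ B , trans (proj₂ B) n∸k≡k+1) A⊆B)

  transfer : (D : TreeDecomposition (Johnson n k)) →
    (∀ i → length (TreeDecomposition.bag D i) ≤ suc t) →
    Σ (TreeDecomposition (BipartiteKneser n k)) λ D′ → ∀ i → length (TreeDecomposition.bag D′ i) ≤ suc t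
  transfer D bag≤ with extendAll (initial D bag≤) (kSubsets n (n ∸ k))
  ... | _ , ⊇ , P = complete (λ B → ⊇ (kSubsets-complete n (n ∸ k) B)) P

-- Treewidth and the constants

foldr-⊔-least : ∀ {n b} (f : Fin n → ℕ) → (∀ i → f i ≤ b) → foldr _⊔_ 0 f ≤ b
foldr-⊔-least {zero}  f f≤b = z≤n
foldr-⊔-least {suc n} f f≤b = ⊔-lub (f≤b zero) (foldr-⊔-least (f ∘ suc) (f≤b ∘ suc))

≤foldr-⊔ : ∀ {n} (f : Fin n → ℕ) i → f i ≤ foldr _⊔_ 0 f
≤foldr-⊔ f zero    = m≤m⊔n (f zero) _
≤foldr-⊔ f (suc i) = ≤-trans (≤foldr-⊔ (f ∘ suc) i) (m≤n⊔m (f zero) _)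

module _ {V : Set} {G : SimpleGraph V} (D : TreeDecomposition G) where
  open TreeDecomposition D

  bag≤1+width : ∀ i → length (bag i) ≤ suc width
  bag≤1+width i = ≤-trans (≤foldr-⊔ (λ j → length (bag j)) i) (m≤n+m∸n _ 1)

  bags≤⇒width≤ : ∀ {t} → (∀ i → length (bag i) ≤ suc t) → width ≤ t
  bags≤⇒width≤ bag≤ = ∸-monoˡ-≤ 1 (foldr-⊔-least (λ j → length (bag j)) bag≤)

  unique-bag⇒≤width : ∀ {K i} → Unique K → All (_∈ bag i) K → length K ≤ suc width
  unique-bag⇒≤width {i = i} u K⊆bag = ≤-trans (unique-⊆⇒length≤ u K⊆bag) (bag≤1+width i)

johnson-treewidth≤nCk : ∀ {n k t} → HasTreewidth (Johnson n k) t → t ≤ n C k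
johnson-treewidth≤nCk {n} {k} tw = ≤-trans (HasTreewidth.minimal tw trivial)
  (bags≤⇒width≤ trivial λ i → ≤-trans
    (unique-⊆⇒length≤ (TreeDecomposition.bag-unique trivial i) (All.universal (kSubsets-complete n k) _))
    (≤-trans (≤-reflexive (length-kSubsets n k)) (n≤1+n _)))
  where
  trivial : TreeDecomposition (Johnson n k)
  trivial = trivialDecomposition _≟ˢ_ (kSubsets n k) (kSubsets-complete n k) (Johnson n k)

n∸k≤johnson-width : ∀ {n k} → k <ℕ n → (D : TreeDecomposition (Johnson n (suc k))) →
  n ∸ k ≤ suc (TreeDecomposition.width D)
n∸k≤johnson-width {n} {k} k<n D with cover-exists k<n
... | A , _ , _ with Cliques.johnson-clique⊆bag D (above-clique A)
...   | i , all = ≤-trans (≤-reflexive (sym length≡))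
  (unique-bag⇒≤width D (clique-unique (above-clique A)) all)
  where
  length≡ : length (above A) ≡ n ∸ k
  length≡ = trans (sym (m+n∸m≡n k (length (above A)))) (cong (_∸ k) (length-above A))

-- The graphs have parameter k + 1 here. The added bags have k + 3 elements, and a clique of n - k ≥
-- k + 3 sets already forces a bag of that size in D.
kneser≤johnson : ∀ {n k s t} → n ∸ suc k ≡ suc (suc k) → k <ℕ n → suc (suc (suc k)) ≤ n ∸ k →
  HasTreewidth (BipartiteKneser n (suc k)) s → HasTreewidth (Johnson n (suc k)) t → s ≤ t
kneser≤johnson {n} {k} {s} e k<n k+3≤n∸k twBK record { attained = D , refl } =
  ≤-trans (HasTreewidth.minimal twBK D′) (bags≤⇒width≤ D′ bag≤)
  where
  t : ℕ
  t = TreeDecomposition.width D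
  transferred : Σ (TreeDecomposition (BipartiteKneser n (suc k))) λ D′ →
    ∀ i → length (TreeDecomposition.bag D′ i) ≤ suc t
  transferred = Transfer.transfer e t (s≤s⁻¹ (≤-trans k+3≤n∸k (n∸k≤johnson-width k<n D))) D (bag≤1+width D)
  D′ : TreeDecomposition (BipartiteKneser n (suc k))
  D′ = proj₁ transferred
  bag≤ : ∀ i → length (TreeDecomposition.bag D′ i) ≤ suc t
  bag≤ = proj₂ transferred

-- An edge puts two distinct vertices into one bag. This yields 1 + t ≤ 2t, which absorbs the
-- difference between bag size and width.
0<kneser-width : ∀ {n k} → n ∸ k ≡ suc k → k <ℕ n → (D : TreeDecomposition (BipartiteKneser n k)) →
  1 ≤ TreeDecomposition.width D
0<kneser-width {n} {k} e k<n D with cover-exists k<n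
... | A , (B , p) , A⋖B
  with TreeDecomposition.edge-covered D {inj₁ A} {inj₂ (B , trans p (sym e))} (⋖⇒⊆ A⋖B)
...   | i , A∈ , B∈ = s≤s⁻¹ (unique-bag⇒≤width D (((λ ()) ∷ []) ∷ [] ∷ []) (A∈ ∷ B∈ ∷ []))

-- The constant is 10 · 3 · 2, from `nCk≤10nm`, n ≤ 3k and 1 + t ≤ 2t.
nCk≤60kt : ∀ k {t} .{{_ : NonZero k}} → (2 *ℕ k + 1) ∸ k ≡ suc k →
  HasTreewidth (BipartiteKneser (2 *ℕ k + 1) k) t → (2 *ℕ k + 1) C k ≤ 60 *ℕ k *ℕ t
nCk≤60kt k e record { attained = D , refl } = begin
  n C k                         ≤⟨ LowerBound.nCk≤10nm e D (bag≤1+width D) {{≢-nonZero n≢0}} ⟩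
  10 *ℕ (n *ℕ (1 + t))          ≤⟨ *-monoʳ-≤ 10 (*-mono-≤ n≤3k (+-monoˡ-≤ t (0<kneser-width e k<n D))) ⟩
  10 *ℕ (3 *ℕ k *ℕ (t + t))     ≡⟨ collect k t ⟩
  60 *ℕ k *ℕ t                  ∎
  where
  open ≤-Reasoning
  n t : ℕ
  n = 2 *ℕ k + 1
  t = TreeDecomposition.width D
  n≡1+2k : n ≡ suc (2 *ℕ k)
  n≡1+2k = +-comm (2 *ℕ k) 1
  n≢0 : n ≢ 0
  n≢0 n≡0 = case trans (sym n≡1+2k) n≡0 of λ ()
  k<n : k <ℕ n
  k<n = ≤-trans (s≤s (m≤m+n k (k + 0))) (≤-reflexive (sym n≡1+2k))
  n≤3k : n ≤ 3 *ℕ k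
  n≤3k = ≤-trans (+-monoʳ-≤ (2 *ℕ k) (>-nonZero⁻¹ k)) (≤-reflexive (three k))
    where
    three : ∀ k → 2 *ℕ k + k ≡ 3 *ℕ k
    three = solve-∀
  collect : ∀ k t → 10 *ℕ (3 *ℕ k *ℕ (t + t)) ≡ 60 *ℕ k *ℕ t
  collect = solve-∀

-- Passage to rational inequalities

toℚᵘ-/ : ∀ m d .{{_ : NonZero d}} → toℚᵘ (+ m / d) ℚᵘ.≃ (+ m ℚᵘ./ d)
toℚᵘ-/ m (suc d) = toℚᵘ-fromℚᵘ (mkℚᵘ (+ m) d)

-- Unnormalised rationals multiply without reducing fractions, so there the claim is an integer
-- inequality after cross-multiplication.
scaled-≤ : ∀ k .{{_ : NonZero k}} N t → N ≤ 60 *ℕ k *ℕ t →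
  (+ 1 / 60) * (+ 1 / k) * ℕ→ℚ N ≤ℚ ℕ→ℚ t
scaled-≤ (suc k) N t N≤60kt = toℚᵘ-cancel-≤ (begin
  toℚᵘ ((+ 1 / 60) * (+ 1 / suc k) * ℕ→ℚ N)
    ≃⟨ toℚᵘ-homo-* ((+ 1 / 60) * (+ 1 / suc k)) (ℕ→ℚ N) ⟩
  toℚᵘ ((+ 1 / 60) * (+ 1 / suc k)) ℚᵘ.* toℚᵘ (ℕ→ℚ N)
    ≃⟨ ℚᵘ.*-cong (ℚᵘ.≃-trans (toℚᵘ-homo-* (+ 1 / 60) (+ 1 / suc k))
         (ℚᵘ.*-cong (toℚᵘ-/ 1 60) (toℚᵘ-/ 1 (suc k)))) (toℚᵘ-/ N 1) ⟩
  mkℚᵘ (+ 1) 59 ℚᵘ.* mkℚᵘ (+ 1) k ℚᵘ.* mkℚᵘ (+ N) 0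
    ≤⟨ *≤* cross-multiplied ⟩
  mkℚᵘ (+ t) 0        ≃⟨ ℚᵘ.≃-sym (toℚᵘ-/ t 1) ⟩
  toℚᵘ (ℕ→ℚ t)        ∎)
  where
  open ℚᵘ.≤-Reasoning
  numerator : ∀ N → 1 *ℕ 1 *ℕ N *ℕ 1 ≡ N
  numerator = solve-∀
  denominator : ∀ k t → 60 *ℕ k *ℕ t ≡ t *ℕ (60 *ℕ k *ℕ 1)
  denominator = solve-∀
  cross-multiplied : (+ 1 ℤ.* + 1 ℤ.* + N) ℤ.* + 1 ℤ.≤ + t ℤ.* + (60 *ℕ suc k *ℕ 1)
  cross-multiplied = subst₂ ℤ._≤_
    (trans (cong (λ a → + a) (sym (numerator N)))
      (trans (ℤ.pos-* (1 *ℕ 1 *ℕ N) 1) (cong (ℤ._* + 1) (ℤ.pos-* (1 *ℕ 1) N))))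
    (trans (cong (λ a → + a) (denominator (suc k) t)) (ℤ.pos-* t (60 *ℕ suc k *ℕ 1)))
    (ℤ.+≤+ N≤60kt)

ℕ→ℚ-mono : ∀ {m n} → m ≤ n → ℕ→ℚ m ≤ℚ ℕ→ℚ n
ℕ→ℚ-mono {m} {n} m≤n = toℚᵘ-cancel-≤ (ℚᵘ.≤-trans (ℚᵘ.≤-reflexive (toℚᵘ-/ m 1))
  (ℚᵘ.≤-trans (*≤* (ℤ.*-monoʳ-≤-nonNeg (+ 1) (ℤ.+≤+ m≤n))) (ℚᵘ.≤-reflexive (ℚᵘ.≃-sym (toℚᵘ-/ n 1)))))

theorem1p4 : Σ ℚ λ c₁ → Σ ℚ λ c₂ → 0ℚ < c₁ × 0ℚ < c₂ ×
    ((k : ℕ) .{{_ : NonZero k}} (tBK tJ : ℕ) →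
    HasTreewidth (BipartiteKneser (2 *ℕ k + 1) k) tBK →
    HasTreewidth (Johnson (2 *ℕ k + 1) k) tJ →
    (c₁ * (+ 1 / k) * ℕ→ℚ ((2 *ℕ k + 1) C k) ≤ℚ ℕ→ℚ tBK) ×
    (tBK ≤ tJ) ×
    (ℕ→ℚ tJ ≤ℚ c₂ * ℕ→ℚ ((2 *ℕ k + 1) C k)))
-- c₁ inverts the factor of `nCk≤60kt`; c₂ = 1 suffices because a single bag holding all k-sets has
-- C(2k+1,k) elements.
theorem1p4 = + 1 / 60 , 1ℚ , positive⁻¹ (+ 1 / 60) , positive⁻¹ 1ℚ , bounds
  where
  bounds : (k : ℕ) .{{_ : NonZero k}} (tBK tJ : ℕ) →
    HasTreewidth (BipartiteKneser (2 *ℕ k + 1) k) tBK →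
    HasTreewidth (Johnson (2 *ℕ k + 1) k) tJ →
    ((+ 1 / 60) * (+ 1 / k) * ℕ→ℚ ((2 *ℕ k + 1) C k) ≤ℚ ℕ→ℚ tBK) ×
    (tBK ≤ tJ) ×
    (ℕ→ℚ tJ ≤ℚ 1ℚ * ℕ→ℚ ((2 *ℕ k + 1) C k))
  bounds k@(suc k′) tBK tJ twBK twJ =
    scaled-≤ k ((2 *ℕ k + 1) C k) tBK (nCk≤60kt k n∸k≡1+k twBK) ,
    kneser≤johnson n∸k≡1+k k′<n k+2≤n∸k′ twBK twJ ,
    subst (ℕ→ℚ tJ ≤ℚ_) (sym (ℚ.*-identityˡ (ℕ→ℚ ((2 *ℕ k + 1) C k))))
      (ℕ→ℚ-mono (johnson-treewidth≤nCk twJ))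
    where
    n∸k≡1+k : (2 *ℕ k + 1) ∸ k ≡ suc k
    n∸k≡1+k = trans (cong (_∸ k) (split k)) (m+n∸m≡n k (suc k))
      where
      split : ∀ k → 2 *ℕ k + 1 ≡ k + suc k
      split = solve-∀
    n≡k′+[k+2] : 2 *ℕ k + 1 ≡ k′ + suc (suc k)
    n≡k′+[k+2] = split k′
      where
      split : ∀ k → 2 *ℕ suc k + 1 ≡ k + suc (suc (suc k))
      split = solve-∀
    k′<n : k′ <ℕ 2 *ℕ k + 1
    k′<n = subst (k′ <ℕ_) (sym n≡k′+[k+2]) (m<m+n k′ (s≤s z≤n))
    k+2≤n∸k′ : suc (suc k) ≤ (2 *ℕ k + 1) ∸ k′
    k+2≤n∸k′ = ≤-reflexive (sym (trans (cong (_∸ k′) n≡k′+[k+2]) (m+n∸m≡n k′ (suc (suc k)))))
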